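{- Let $G^\sigma$ be a connected signed graph of order $n\ge 3$ that contains a cycle, let $g(G^\sigma)$ be its girth, and assume $g(G^\sigma)<n$. Then for any real eigenvalue $\lambda$ of the adjacency matrix $A(G^\sigma)$, \[ m(G^\sigma,\lambda)\le n-g(G^\sigma)+2, \] and equality holds if and only if one of the following holds: (i) $G^\sigma$ is a balanced complete signed graph $K_n^\sigma$ and $\lambda=-1$; (ii) $G^\sigma$ is an antibalanced complete signed graph $K_n^\sigma$ and $\lambda=1$; (iii) $G^\sigma$ is a balanced complete bipartite signed graph $K_{n_1,n_2}^\sigma$ with $n_1,n_2\ge 2$ and $\lambda=0$.
   Context: All graphs are finite, simple and undirected. A signed graph $G^\sigma=(G,\sigma)$ consists of an underlying graph $G=(V,E)$ and a sign function $\sigma:E\to\{+1,-1\}$. Its order is $n=|V|$. It is connected if $G$ is connected, and its girth $g(G^\sigma)$ is the length of a shortest cycle of $G$. The adjacency matrix $A(G^\sigma)=[a^\sigma_{ij}]$ is the real symmetric $n\times n$ matrix with $a^\sigma_{ij}=\sigma(v_iv_j)$ if $v_i$ and $v_j$ are adjacent and $a^\sigma_{ij}=0$ otherwise. $m(G^\sigma,\lambda)$ denotes the multiplicity of $\lambda$ as an eigenvalue of $A(G^\sigma)$, i.e. $m(G^\sigma,\lambda)=n-\operatorname{rank}(\lambda I-A(G^\sigma))$. The sign of a cycle is the product of the signs of its edges. $G^\sigma$ is balanced if every cycle has sign $+1$, and antibalanced if every even cycle has sign $+1$ and every odd cycle has sign $-1$. $K_n^\sigma$ (resp. $K_{n_1,n_2}^\sigma$)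 denotes a signed graph whose underlying graph is the complete graph $K_n$ (resp. the complete bipartite graph $K_{n_1,n_2}$, with $n_1+n_2=n$). -}

module Defs where

open import Algebra.Bundles using (CommutativeRing)
open import Algebra.Properties.Ring using (-1*x≈-x; -‿involutive)
open import Algebra.Properties.Semiring.Sum using (sum)
open import Data.Fin.Base using (Fin; inject₁; fromℕ) renaming (zero to fzero; suc to fsuc)
open import Data.Fin.Properties using (_≟_)
open import Data.Fin.Subset using (Subset; _∈_; _∉_; ∣_∣; ∁; ⊥)
open import Data.Fin.Subset.Properties using (anySubset?; ∣p∣≤n; ∉⊥; ∣⊥∣≡0)
open import Data.Nat.Base as ℕ using (ℕ; zero; suc)
open import Data.Nat.Divisibility using (_∣_)
import Data.Nat.Properties as ℕ
open import Data.Product.Base using (∃; ∃-syntax; _×_; _,_; proj₁; proj₂)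
open import Data.Sign.Base as Sign using (Sign)
open import Data.Sum.Base using (_⊎_; inj₁; inj₂)
open import Data.Vec.Functional using (foldr)
open import Function.Bundles using (_⇔_)
open import Function.Definitions using (Injective)
open import Level using (Level; _⊔_) renaming (zero to lzero; suc to lsuc)
open import Relation.Binary.Construct.Closure.ReflexiveTransitive using (Star)
open import Relation.Binary.Core using (Rel)
open import Relation.Binary.Definitions using (Decidable; Symmetric; Irreflexive)
open import Relation.Binary.PropositionalEquality using (_≡_; _≢_)
open import Relation.Binary.Structures using (IsDecTotalOrder)
open import Relation.Nullary.Decidable using (Dec; yes; no; map′; _×-dec_; decidable-stable)
open import Relation.Nullary.Negation using (¬_; contradiction)
open import Relation.Unary using (Pred)

-- Classically, these axioms characterise ℝ up to isomorphism.
record CompleteOrderedField (c ℓ : Level) : Set (lsuc (c ⊔ ℓ)) where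
  infix 4 _≤_
  field
    commutativeRing : CommutativeRing c ℓ

  open CommutativeRing commutativeRing public
    hiding (refl; sym; trans; reflexive; isEquivalence; isPartialEquivalence; setoid)

  field
    _≤_             : Rel Carrier ℓ
    isDecTotalOrder : IsDecTotalOrder _≈_ _≤_
    0≉1             : ¬ (0# ≈ 1#)
    inverse         : ∀ x → ¬ (x ≈ 0#) → ∃[ y ] x * y ≈ 1#
    +-monoʳ-≤       : ∀ x {y z} → y ≤ z → x + y ≤ x + z
    *-nonNegative   : ∀ {x y} → 0# ≤ x → 0# ≤ y → 0# ≤ x * y

  UpperBound : Pred Carrier (c ⊔ ℓ) → Pred Carrier (c ⊔ ℓ)
  UpperBound P u = ∀ x → P x → x ≤ u

  field
    supremum : ∀ (P : Pred Carrier (c ⊔ ℓ)) → ∃ P → ∃ (UpperBound P) →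
               ∃[ s ] UpperBound P s × (∀ u → UpperBound P u → s ≤ u)

record SignedGraph (n : ℕ) : Set₁ where
  infix 4 _~_
  field
    _~_      : Rel (Fin n) lzero
    _~?_     : Decidable _~_
    ~-sym    : Symmetric _~_
    ~-irrefl : Irreflexive _≡_ _~_
    σ        : ∀ {i j} → i ~ j → Sign
    -- The sign depends only on the unordered pair {i , j}: applied twice,
    -- this also yields independence of the adjacency proof.
    σ-sym    : ∀ {i j} (p : i ~ j) (q : j ~ i) → σ p ≡ σ q

module _ {n : ℕ} (G : SignedGraph n) where
  open SignedGraph G

  Connected : Set
  Connected = ∀ i j → Star _~_ i j

  record Cycle : Set where
    field
      m         : ℕ
      2≤m       : 2 ℕ.≤ m
      vertex    : Fin (suc m) → Fin n
      injective : Injective _≡_ _≡_ vertex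
      edge      : ∀ (k : Fin m) → vertex (inject₁ k) ~ vertex (fsuc k)
      closing   : vertex (fromℕ m) ~ vertex fzero

    length : ℕ
    length = suc m

    sign : Sign
    sign = foldr Sign._*_ (σ closing) (λ k → σ (edge k))

  IsGirth : ℕ → Set
  IsGirth g = (∃[ C ] Cycle.length C ≡ g) × (∀ C → g ℕ.≤ Cycle.length C)

  Balanced : Set
  Balanced = ∀ C → Cycle.sign C ≡ Sign.+

  Antibalanced : Set
  Antibalanced = ∀ C → (2 ∣ Cycle.length C → Cycle.sign C ≡ Sign.+)
                     × (¬ (2 ∣ Cycle.length C) → Cycle.sign C ≡ Sign.-)

  IsComplete : Set
  IsComplete = ∀ i j → i ≢ j → i ~ j

  IsCompleteBipartite : ℕ → ℕ → Set
  IsCompleteBipartite n₁ n₂ =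
    ∃[ S ] ∣ S ∣ ≡ n₁ × ∣ ∁ S ∣ ≡ n₂ ×
           (∀ i j → i ~ j ⇔ ((i ∈ S × j ∉ S) ⊎ (i ∉ S × j ∈ S)))

module Spectral {c ℓ : Level} (ℝ : CompleteOrderedField c ℓ) where
  open CompleteOrderedField ℝ
  open IsDecTotalOrder isDecTotalOrder
    using (antisym; total; _≤?_; ≤-respʳ-≈; ≤-respˡ-≈; module Eq)
    renaming (_≟_ to _≈?_; trans to ≤-trans; reflexive to ≤-reflexive)

  Matrix : ℕ → ℕ → Set c
  Matrix m n = Fin m → Fin n → Carrier

  _·_ : ∀ {m n} → Matrix m n → (Fin n → Carrier) → Fin m → Carrier
  (M · x) i = sum semiring (λ j → M i j * x j)

  IndependentColumns : ∀ {m n} → Matrix m n → Subset n → Set (c ⊔ ℓ)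
  IndependentColumns M S =
    ∀ x → (∀ j → j ∉ S → x j ≈ 0#) → (∀ i → (M · x) i ≈ 0#) → ∀ j → x j ≈ 0#

  IsRank : ∀ {m n} → Matrix m n → ℕ → Set (c ⊔ ℓ)
  IsRank M r = (∃[ S ] IndependentColumns M S × ∣ S ∣ ≡ r)
             × (∀ S → IndependentColumns M S → ∣ S ∣ ℕ.≤ r)

  -- The rank always exists.  Completeness decides every negated
  -- proposition P: compare the supremum of {0} ∪ {1 ∣ P} with 0.  Linear
  -- independence is ¬¬-stable, hence decidable.
  abstract
    private
      1≰0 : ¬ (1# ≤ 0#)
      1≰0 1≤0 = 0≉1 (antisym 0≤1 1≤0)
        where
        0≤-1 : 0# ≤ - 1#
        0≤-1 = ≤-respˡ-≈ (-‿inverseˡ 1#)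
                 (≤-respʳ-≈ (+-identityʳ (- 1#)) (+-monoʳ-≤ (- 1#) 1≤0))
        0≤1 : 0# ≤ 1#
        0≤1 = ≤-respʳ-≈
                (Eq.trans (-1*x≈-x ring (- 1#)) (-‿involutive ring 1#))
                (*-nonNegative 0≤-1 0≤-1)

      0≤1 : 0# ≤ 1#
      0≤1 with total 0# 1#
      ... | inj₁ p = p
      ... | inj₂ p = contradiction p 1≰0

      ¬-dec : (P : Set (c ⊔ ℓ)) → Dec (¬ P)
      ¬-dec P = decide (supremum Q (0# , inj₁ Eq.refl) (1# , Q≤1))
        where
        Q : Pred Carrier (c ⊔ ℓ)
        Q x = (x ≈ 0#) ⊎ (x ≈ 1# × P)

        Q≤1 : UpperBound Q 1#
        Q≤1 x (inj₁ x≈0)       = ≤-respˡ-≈ (Eq.sym x≈0) 0≤1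
        Q≤1 x (inj₂ (x≈1 , _)) = ≤-reflexive x≈1

        Q≤0 : ¬ P → UpperBound Q 0#
        Q≤0 ¬p x (inj₁ x≈0)     = ≤-reflexive x≈0
        Q≤0 ¬p x (inj₂ (_ , p)) = contradiction p ¬p

        decide : (∃[ s ] UpperBound Q s × (∀ u → UpperBound Q u → s ≤ u)) →
                 Dec (¬ P)
        decide (s , Q≤s , least) with s ≤? 0#
        ... | yes s≤0 = yes λ p → 1≰0 (≤-trans (Q≤s 1# (inj₂ (Eq.refl , p))) s≤0)
        ... | no  s≰0 = no λ ¬p → s≰0 (least 0# (Q≤0 ¬p))

      independent? : ∀ {m n} (M : Matrix m n) S → Dec (IndependentColumns M S)
      independent? M S = map′
        (λ ¬¬I x x∉ Mx j → decidable-stable (x j ≈? 0#)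
          λ x≉0 → ¬¬I λ I → x≉0 (I x x∉ Mx j))
        (λ I ¬I → ¬I I)
        (¬-dec (¬ IndependentColumns M S))

      search : ∀ {m n} (M : Matrix m n) b →
               (∀ S → IndependentColumns M S → ∣ S ∣ ℕ.≤ b) → ∃ (IsRank M)
      search M b bound
        with anySubset? (λ S → independent? M S ×-dec (∣ S ∣ ℕ.≟ b))
      search M b       bound | yes w = b , w , bound
      search {n = n} M zero bound | no ¬w =
        contradiction (⊥ , (λ x x∉⊥ _ j → x∉⊥ j ∉⊥) , ∣⊥∣≡0 n) ¬w
      search M (suc b) bound | no ¬w = search M b λ S I →
        ℕ.≤-pred (ℕ.≤∧≢⇒< (bound S I) (λ eq → ¬w (S , I , eq)))

    rank-exists : ∀ {m n} (M : Matrix m n) → ∃ (IsRank M)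
    rank-exists {n = n} M = search M n (λ S _ → ∣p∣≤n S)

  rank : ∀ {m n} → Matrix m n → ℕ
  rank M = proj₁ (rank-exists M)

  rank-isRank : ∀ {m n} (M : Matrix m n) → IsRank M (rank M)
  rank-isRank M = proj₂ (rank-exists M)

  identity : ∀ {n} → Matrix n n
  identity i j with i ≟ j
  ... | yes _ = 1#
  ... | no  _ = 0#

  signValue : Sign → Carrier
  signValue Sign.+ = 1#
  signValue Sign.- = - 1#

  module _ {n : ℕ} (G : SignedGraph n) where
    open SignedGraph G

    adjacency : Matrix n n
    adjacency i j with i ~? j
    ... | yes p = signValue (σ p)
    ... | no  _ = 0#

    IsEigenvalue : Carrier → Set (c ⊔ ℓ)
    IsEigenvalue μ = ∃[ x ] (∃[ i ] ¬ (x i ≈ 0#))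
                          × (∀ i → (adjacency · x) i ≈ μ * x i)

    multiplicity : Carrier → ℕ
    multiplicity μ = n ℕ.∸ rank (λ i j → μ * identity i j - adjacency i j)

{-# OPTIONS --safe #-}

-- Write M = μI − A and let v₀ … vₘ be a shortest cycle, so that g = m + 1.  The columns v₁ … v_{m−1}
-- of M are independent, because v₀ … v_{m−1} is an induced path and the rows v₀ … v_{m−2} are
-- triangular on them; hence rank M ≥ g − 2.  By connectedness some u off the cycle is adjacent to,
-- say, v₀.  If u has no neighbour among v₁ … v_{m−1}, then u v₀ … v_{m−1} is a longer induced path
-- and rank M ≥ g − 1.  Otherwise minimality of the cycle forces g ≤ 4 and u ~ v_{m−1}.  If g = 3 and
-- rank M = 1, the vanishing 2×2 minors make M a multiple of ttᵀ with t = ±1 entrywise.  If g = 4 and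
-- rank M = 2, the independent set {v₁, v₃, u} forces μ = 0, and the vanishing Schur complement of the
-- block on an edge xy expresses every entry of A through the rows of x and y.  Conversely, in the three
-- extremal families two suitable columns of M are always proportional.
module Submission where

open import Defs
import Algebra.Properties.Ring
import Algebra.Properties.Semiring.Sum
import Algebra.Solver.Ring.NaturalCoefficients.Default
open import Data.Fin.Base as Fin using (Fin; toℕ; fromℕ; fromℕ<; inject₁)
  renaming (zero to fzero; suc to fsuc)
open import Data.Fin.Properties as Fin
  using (any?; pigeonhole; ¬∀⟶∃¬; toℕ-injective; toℕ-fromℕ; toℕ-fromℕ<; toℕ-inject₁; toℕ<n)
open import Data.Fin.Subset using (Subset; inside; outside; _∈_; _∉_; ∣_∣; ∁; ⊥; ⁅_⁆; _∪_)
open import Data.Fin.Subset.Properties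
  using (∉⊥; x∈⁅x⁆; x∈⁅y⁆⇒x≡y; x∈p∪q⁻; x∈p∪q⁺; q⊆p∪q; p⊂q⇒∣p∣<∣q∣; p⊆q⇒∣p∣≤∣q∣;
         _∈?_; x∉p⇒x∈∁p; ∣p∣≤n)
open import Data.Nat.Base as ℕ using (ℕ; zero; suc; z≤n; s≤s)
open import Data.Nat.Divisibility using (_∣_; _∣?_; _∣0; divides; ∣m∣n⇒∣m+n)
open import Data.Nat.DivMod using (_mod_; m<n⇒m%n≡m; m%n<n)
import Data.Nat.Properties as ℕ
open import Data.Product.Base using (∃₂; ∃-syntax; _×_; _,_; proj₁; proj₂)
open import Data.Sign.Base as Sign using (Sign)
import Data.Sign.Properties as Sign
open import Data.Sum.Base using (_⊎_; inj₁; inj₂)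
open import Data.Vec.Base using ([]; _∷_; here; there; tabulate)
open import Data.Vec.Functional as Vector using (foldr)
open import Data.Vec.Properties using (lookup⇒[]=; []=⇒lookup; lookup∘tabulate)
open import Function.Base using (_∘_)
open import Function.Bundles using (_⇔_; mk⇔; Equivalence)
open import Function.Definitions using (Injective)
open import Level using (Level; _⊔_)
open import Relation.Binary.Construct.Closure.ReflexiveTransitive using (Star; _◅_)
  renaming (ε to nil)
open import Relation.Binary.Definitions using (tri<; tri≈; tri>)
open import Relation.Binary.PropositionalEquality
  using (_≡_; _≢_; refl; sym; trans; cong; cong₂; subst; subst₂; module ≡-Reasoning)
open import Relation.Binary.Bundles using (Setoid)
import Relation.Binary.Reasoning.Setoid
open import Relation.Binary.Structures using (IsDecTotalOrder)
open import Relation.Nullary.Decidable using (Dec; yes; no; does; dec-true; from-no; decidable-stable)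
open import Relation.Nullary.Negation using (¬_; contradiction)

-- Lists of distinct elements, subsets and powers of signs

∷-injective : ∀ {a} {A : Set a} {k} {x : A} {v : Fin k → A} → (∀ t → x ≢ v t) →
              Injective _≡_ _≡_ v → Injective _≡_ _≡_ (x Vector.∷ v)
∷-injective x∉v inj {fzero}  {fzero}  _  = refl
∷-injective x∉v inj {fzero}  {fsuc j} eq = contradiction eq (x∉v j)
∷-injective x∉v inj {fsuc i} {fzero}  eq = contradiction (sym eq) (x∉v i)
∷-injective x∉v inj {fsuc i} {fsuc j} eq = cong fsuc (inj eq)

[]-injective : ∀ {a} {A : Set a} → Injective _≡_ _≡_ (Vector.[] {A = A})
[]-injective {x = ()}

pair-injective : ∀ {a} {A : Set a} {x y : A} → x ≢ y →
                 Injective _≡_ _≡_ (x Vector.∷ y Vector.∷ Vector.[])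
pair-injective x≢y =
  ∷-injective (λ { fzero → x≢y }) (∷-injective (λ ()) []-injective)

triple-injective : ∀ {a} {A : Set a} {x y z : A} → x ≢ y → x ≢ z → y ≢ z →
                   Injective _≡_ _≡_ (x Vector.∷ y Vector.∷ z Vector.∷ Vector.[])
triple-injective x≢y x≢z y≢z =
  ∷-injective (λ { fzero → x≢y ; (fsuc fzero) → x≢z }) (pair-injective y≢z)

module _ {n : ℕ} where

  image : ∀ {k} → (Fin k → Fin n) → Subset n
  image {zero}  c = ⊥
  image {suc k} c = ⁅ c fzero ⁆ ∪ image (c ∘ fsuc)

  ∈-image⁺ : ∀ {k} (c : Fin k → Fin n) t → c t ∈ image c
  ∈-image⁺ c fzero    = x∈p∪q⁺ (inj₁ (x∈⁅x⁆ (c fzero)))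
  ∈-image⁺ c (fsuc t) = x∈p∪q⁺ (inj₂ (∈-image⁺ (c ∘ fsuc) t))

  ∈-image⁻ : ∀ {k} (c : Fin k → Fin n) {j} → j ∈ image c → ∃[ t ] j ≡ c t
  ∈-image⁻ {zero}  c j∈ = contradiction j∈ ∉⊥
  ∈-image⁻ {suc k} c j∈ with x∈p∪q⁻ ⁅ c fzero ⁆ _ j∈
  ... | inj₁ j∈₀ = fzero , x∈⁅y⁆⇒x≡y _ j∈₀
  ... | inj₂ j∈ₛ with t , eq ← ∈-image⁻ (c ∘ fsuc) j∈ₛ = fsuc t , eq

  ∣image∣ : ∀ {k} (c : Fin k → Fin n) → Injective _≡_ _≡_ c → k ℕ.≤ ∣ image c ∣
  ∣image∣ {zero}  c inj = z≤n
  ∣image∣ {suc k} c inj = ℕ.≤-trans (s≤s (∣image∣ (c ∘ fsuc) (Fin.suc-injective ∘ inj)))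
    (p⊂q⇒∣p∣<∣q∣ (q⊆p∪q ⁅ c fzero ⁆ _ , c fzero , ∈-image⁺ c fzero , c₀∉))
    where
    c₀∉ : c fzero ∉ image (c ∘ fsuc)
    c₀∉ c₀∈ with t , eq ← ∈-image⁻ (c ∘ fsuc) c₀∈ with () ← inj eq

-- Turns a cardinality bound into an explicit list of distinct elements: an independent set of
-- columns that is too large then yields a family of prescribed length.
select : ∀ {n} k (S : Subset n) → k ℕ.≤ ∣ S ∣ →
         ∃[ c ] Injective _≡_ _≡_ c × (∀ (t : Fin k) → c t ∈ S)
select zero    S             k≤ = (λ ()) , (λ { {()} }) , λ ()
select (suc k) (outside ∷ S) k≤ with c , inj , c∈ ← select (suc k) S k≤ =
  fsuc ∘ c , inj ∘ Fin.suc-injective , there ∘ c∈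
select (suc k) (inside  ∷ S) k≤ with c , inj , c∈ ← select k S (ℕ.≤-pred k≤) =
  fzero Vector.∷ (fsuc ∘ c) ,
  ∷-injective (λ _ ()) (inj ∘ Fin.suc-injective) ,
  λ { fzero → here ; (fsuc t) → there (c∈ t) }

infixr 8 _^ˢ_
_^ˢ_ : Sign → ℕ → Sign
ε ^ˢ zero  = Sign.+
ε ^ˢ suc k = ε Sign.* ε ^ˢ k

+^ˢ : ∀ k → Sign.+ ^ˢ k ≡ Sign.+
+^ˢ zero    = refl
+^ˢ (suc k) = +^ˢ k

-^ˢ-even : ∀ q → Sign.- ^ˢ (q ℕ.* 2) ≡ Sign.+
-^ˢ-even zero    = refl
-^ˢ-even (suc q) = cong (λ s → Sign.- Sign.* (Sign.- Sign.* s)) (-^ˢ-even q)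

-^ˢ-odd : ∀ k → ¬ 2 ∣ k → Sign.- ^ˢ k ≡ Sign.-
-^ˢ-odd zero          2∤k = contradiction (2 ∣0) 2∤k
-^ˢ-odd (suc zero)    2∤k = refl
-^ˢ-odd (suc (suc k)) 2∤k = cong (λ s → Sign.- Sign.* (Sign.- Sign.* s))
  (-^ˢ-odd k λ 2∣k → 2∤k (∣m∣n⇒∣m+n (divides 1 refl) 2∣k))

toℕ-mod : ∀ {i m} → i ℕ.≤ m → toℕ (i mod suc m) ≡ i
toℕ-mod {i} {m} i≤m = trans (toℕ-fromℕ< (m%n<n i (suc m))) (m<n⇒m%n≡m (s≤s i≤m))

mod-toℕ : ∀ {m} (k : Fin (suc m)) → toℕ k mod suc m ≡ k
mod-toℕ k = toℕ-injective (toℕ-mod (ℕ.≤-pred (toℕ<n k)))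

-- Paths and cycles

cons : ∀ {a} {A : Set a} → A → (ℕ → A) → ℕ → A
cons u f zero    = u
cons u f (suc i) = f i

module _ {n : ℕ} (G : SignedGraph n) where
  open SignedGraph G
  open import Data.Nat.Base using (_≤_; _<_; _+_)

  -- Vertices are indexed by `ℕ` and only the values up to `m`, the number of edges, are
  -- constrained. Prefixes, shifts and `cons` then need no coercions between `Fin` types.
  record Path (m : ℕ) (f : ℕ → Fin n) : Set where
    field
      step      : ∀ {i} → i < m → f i ~ f (suc i)
      injective : ∀ {i j} → i ≤ m → j ≤ m → f i ≡ f j → i ≡ j

  record Circuit (m : ℕ) (f : ℕ → Fin n) : Set where
    field
      path  : Path m f
      close : f m ~ f 0
    open Path path public

  -- A chord is recorded by its lower end `i` and its span `d`; a chordless path is an induced path.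
  Chordless : ℕ → (ℕ → Fin n) → Set
  Chordless m f = ∀ {i d} → 2 ≤ d → d + i ≤ m → ¬ f i ~ f (d + i)

  Avoids : Fin n → ℕ → (ℕ → Fin n) → Set
  Avoids u m f = ∀ {i} → i ≤ m → u ≢ f i

  prefix : ∀ {k m f} → k ≤ m → Path m f → Path k f
  prefix k≤m P = record
    { step      = λ i<k → step (ℕ.≤-trans i<k k≤m)
    ; injective = λ i≤k j≤k → injective (ℕ.≤-trans i≤k k≤m) (ℕ.≤-trans j≤k k≤m)
    }
    where open Path P

  drop : ∀ {m f} d i → d + i ≤ m → Path m f → Path d (f ∘ (_+ i))
  drop d i d+i≤m P = record
    { step      = λ j<d → step (ℕ.≤-trans (ℕ.+-monoˡ-≤ i j<d) d+i≤m)
    ; injective = λ j≤d k≤d eq → ℕ.+-cancelʳ-≡ i _ _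
        (injective (ℕ.≤-trans (ℕ.+-monoˡ-≤ i j≤d) d+i≤m)
                   (ℕ.≤-trans (ℕ.+-monoˡ-≤ i k≤d) d+i≤m) eq)
    }
    where open Path P

  cons-path : ∀ {k f u} → u ~ f 0 → Avoids u k f → Path k f → Path (suc k) (cons u f)
  cons-path {k} {f} {u} u~f₀ u∉ P = record { step = step′ ; injective = injective′ }
    where
    open Path P
    step′ : ∀ {i} → i < suc k → cons u f i ~ f i
    step′ {zero}  _         = u~f₀
    step′ {suc i} (s≤s i<k) = step i<k
    injective′ : ∀ {i j} → i ≤ suc k → j ≤ suc k → cons u f i ≡ cons u f j → i ≡ j
    injective′ {zero}  {zero}  _         _         _  = refl
    injective′ {zero}  {suc j} _         (s≤s j≤k) eq = contradiction eq (u∉ j≤k)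
    injective′ {suc i} {zero}  (s≤s i≤k) _         eq = contradiction (sym eq) (u∉ i≤k)
    injective′ {suc i} {suc j} (s≤s i≤k) (s≤s j≤k) eq = cong suc (injective i≤k j≤k eq)

  cons-circuit : ∀ {k f u} → u ~ f 0 → u ~ f k → Avoids u k f → Path k f →
                 Circuit (suc k) (cons u f)
  cons-circuit u~f₀ u~fₖ u∉ P = record { path = cons-path u~f₀ u∉ P ; close = ~-sym u~fₖ }

  -- The closing edge becomes the first step, and the last step, reversed, becomes the closing edge.
  rotate : ∀ {m f} → Circuit (suc m) f → Circuit (suc m) (cons (f (suc m)) f)
  rotate {m} {f} C = cons-circuit close (~-sym (step ℕ.≤-refl)) last∉ (prefix (ℕ.n≤1+n m) path)
    where
    open Circuit C
    last∉ : Avoids (f (suc m)) m f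
    last∉ i≤m eq = ℕ.1+n≰n (subst (_≤ m) (sym (injective ℕ.≤-refl (ℕ.m≤n⇒m≤1+n i≤m) eq)) i≤m)

  rotate-avoids : ∀ {m f u} → Avoids u (suc m) f → Avoids u (suc m) (cons (f (suc m)) f)
  rotate-avoids u∉ {zero}  _         = u∉ ℕ.≤-refl
  rotate-avoids u∉ {suc i} (s≤s i≤m) = u∉ (ℕ.m≤n⇒m≤1+n i≤m)

  -- Each rotation raises the index of the neighbour of `u` by one, and from index `suc m` one more
  -- rotation brings it to the front. `d` counts the rotations before that last one.
  rotate-to : ∀ {m u} d k {f} → d + k ≡ suc m → Circuit (suc m) f → Avoids u (suc m) f →
              u ~ f k → ∃[ f′ ] Circuit (suc m) f′ × Avoids u (suc m) f′ × u ~ f′ 0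
  rotate-to zero    k refl C u∉ u~fₖ = _ , rotate C , rotate-avoids u∉ , u~fₖ
  rotate-to (suc d) k eq   C u∉ u~fₖ =
    rotate-to d (suc k) (trans (ℕ.+-suc d k) eq) (rotate C) (rotate-avoids u∉) u~fₖ

  cycle⇒circuit : (C : Cycle G) → Circuit (Cycle.m C) (λ i → Cycle.vertex C (i mod suc (Cycle.m C)))
  cycle⇒circuit C = record
    { path = record
      { step      = λ {i} i<m → subst₂ (λ a b → vertex a ~ vertex b)
                      (toℕ-injective (trans (toℕ-inject₁ _)
                        (trans (toℕ-fromℕ< i<m) (sym (toℕ-mod (ℕ.<⇒≤ i<m))))))
                      (toℕ-injective (trans (cong suc (toℕ-fromℕ< i<m)) (sym (toℕ-mod i<m))))
                      (edge (fromℕ< i<m))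
      ; injective = λ i≤m j≤m eq → trans (sym (toℕ-mod i≤m))
                      (trans (cong toℕ (injective eq)) (toℕ-mod j≤m))
      }
    ; close = subst (λ a → vertex a ~ vertex fzero)
                (toℕ-injective (trans (toℕ-fromℕ m) (sym (toℕ-mod ℕ.≤-refl)))) closing
    }
    where open Cycle C

  circuit⇒cycle : ∀ {m f} → 2 ≤ m → Circuit m f → Cycle G
  circuit⇒cycle {m} {f} 2≤m C = record
    { m         = m
    ; 2≤m       = 2≤m
    ; vertex    = f ∘ toℕ
    ; injective = λ {i} {j} eq → toℕ-injective
        (injective (ℕ.≤-pred (toℕ<n i)) (ℕ.≤-pred (toℕ<n j)) eq)
    ; edge      = λ k → subst (λ i → f i ~ f (suc (toℕ k))) (sym (toℕ-inject₁ k)) (step (toℕ<n k))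
    ; closing   = subst (λ i → f i ~ f 0) (sym (toℕ-fromℕ m)) close
    }
    where open Circuit C

  girth≤ : ∀ {g} → IsGirth G g → ∀ {m f} → 2 ≤ m → Circuit m f → g ≤ suc m
  girth≤ (_ , shortest) 2≤m C = shortest (circuit⇒cycle 2≤m C)

  triangle : ∀ {a b c} → a ~ b → b ~ c → c ~ a → Cycle G
  triangle {a} {b} {c} p q r = record
    { m         = 2
    ; 2≤m       = ℕ.≤-refl
    ; vertex    = a Vector.∷ b Vector.∷ c Vector.∷ Vector.[]
    ; injective = triple-injective (λ eq → ~-irrefl eq p) (λ eq → ~-irrefl (sym eq) r)
                    (λ eq → ~-irrefl eq q)
    ; edge      = λ { fzero → p ; (fsuc fzero) → q }
    ; closing   = r
    }

  square : ∀ {a b c d} → a ≢ c → b ≢ d → a ~ b → b ~ c → c ~ d → d ~ a → Cycle G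
  square {a} {b} {c} {d} a≢c b≢d p q r s = record
    { m         = 3
    ; 2≤m       = s≤s (s≤s z≤n)
    ; vertex    = a Vector.∷ b Vector.∷ c Vector.∷ d Vector.∷ Vector.[]
    ; injective = ∷-injective
        (λ { fzero eq → ~-irrefl eq p ; (fsuc fzero) → a≢c
           ; (fsuc (fsuc fzero)) eq → ~-irrefl (sym eq) s })
        (triple-injective (λ eq → ~-irrefl eq q) b≢d (λ eq → ~-irrefl eq r))
    ; edge      = λ { fzero → p ; (fsuc fzero) → q ; (fsuc (fsuc fzero)) → r }
    ; closing   = s
    }

  3≤length : ∀ {g} → IsGirth G g → 3 ≤ g
  3≤length ((C , refl) , _) = s≤s (Cycle.2≤m C)

  no-triangle : ∀ {g} → IsGirth G g → 4 ≤ g → ∀ {a b c} → a ~ b → b ~ c → ¬ c ~ a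
  no-triangle (_ , shortest) 4≤g p q r = ℕ.1+n≰n (ℕ.≤-trans 4≤g (shortest (triangle p q r)))

  -- A chord of span `d` would close the stretch between its ends into a circuit of length `suc d`,
  -- which is below the girth. The bound `m` leaves out `f (suc m)`, which may well be joined to
  -- `f 0`.
  girth-chordless : ∀ {m f} → IsGirth G (suc (suc m)) → Path (suc m) f → Chordless m f
  girth-chordless {m} girth P {i} {d} 2≤d d+i≤m p =
    ℕ.1+n≰n (ℕ.≤-trans (ℕ.≤-pred (girth≤ girth 2≤d circuit))
                       (ℕ.≤-trans (ℕ.m≤m+n d i) d+i≤m))
    where
    circuit : Circuit d _
    circuit = record { path = drop d i (ℕ.m≤n⇒m≤1+n d+i≤m) P ; close = ~-sym p }

  -- A second neighbour `f (suc i)` of `u` closes the circuit u, f 0, ..., f (i + 1), and minimality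
  -- forces i + 1 = m. The other arc then gives the circuit u, f m, f (m + 1), f 0 of length 4, so
  -- the girth is at most 4. Without such a neighbour, `u` prolongs the induced path f 0, ..., f m.
  attach : ∀ {m f u} → IsGirth G (suc (suc m)) → 1 ≤ m → Circuit (suc m) f →
           Avoids u (suc m) f → u ~ f 0 →
           (Path (suc m) (cons u f) × Chordless (suc m) (cons u f))
           ⊎ (suc m ≤ 3 × u ~ f m)
  attach {m} {f} {u} girth 1≤m C u∉ u~f₀ with any? (λ (i : Fin m) → u ~? f (suc (toℕ i)))
  ... | no none = inj₁ (cons-path u~f₀ (u∉ ∘ ℕ.m≤n⇒m≤1+n) (prefix (ℕ.n≤1+n m) path) , chordless)
    where
    open Circuit C
    chordless : Chordless (suc m) (cons u f)
    chordless {zero}  {suc (suc d)} _ (s≤s d<m) p =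
      none (fromℕ< d<m , subst (λ i → u ~ f (suc i)) (sym (toℕ-fromℕ< d<m)) p)
    chordless {zero}  {suc zero} (s≤s ()) _ _
    -- A chord that avoids `u` is a chord of the original path, with indices shifted by one.
    chordless {suc i} {d} 2≤d d+i≤ p = girth-chordless girth path 2≤d
      (ℕ.≤-pred (subst (_≤ suc m) (ℕ.+-suc d i) d+i≤))
      (subst (λ j → f i ~ cons u f j) (ℕ.+-suc d i) p)
  ... | yes (i , u~fᵢ) = inj₂ (ℕ.≤-pred (girth≤ girth (s≤s (s≤s z≤n)) short) , u~fₘ)
    where
    open Circuit C
    i≤ : toℕ i < m
    i≤ = toℕ<n i
    long : Circuit (suc (suc (toℕ i))) (cons u f)
    long = cons-circuit u~f₀ u~fᵢ (λ j≤ → u∉ (ℕ.≤-trans j≤ (ℕ.m≤n⇒m≤1+n i≤)))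
             (prefix (ℕ.m≤n⇒m≤1+n i≤) path)
    m≡ : suc (toℕ i) ≡ m
    m≡ = ℕ.≤-antisym i≤ (ℕ.≤-pred (ℕ.≤-pred (girth≤ girth (s≤s (s≤s z≤n)) long)))
    u~fₘ : u ~ f m
    u~fₘ = subst (λ j → u ~ f j) m≡ u~fᵢ
    -- Two rotations bring f m, f (m + 1), f 0 to the front.
    short : Circuit 3 _
    short = cons-circuit u~fₘ u~f₀
      (λ j≤2 → rotate-avoids (rotate-avoids u∉) (ℕ.≤-trans j≤2 (s≤s 1≤m)))
      (prefix (s≤s 1≤m) (Circuit.path (rotate (rotate C))))

  -- A vertex attached to a shortest cycle

  leave : (P : Fin n → Set) → (∀ i → Dec (P i)) → ∀ {i j} → Star _~_ i j → ¬ P i → P j →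
          ∃₂ λ u w → ¬ P u × P w × u ~ w
  leave P P? nil      ¬Pi Pj = contradiction Pj ¬Pi
  leave P P? (_◅_ {j = k} p ps) ¬Pi Pj with P? k
  ... | yes Pk = _ , k , ¬Pi , Pk , p
  ... | no ¬Pk = leave P P? ps ¬Pk Pj

  module _ (conn : Connected G) (C : Cycle G) (len<n : Cycle.length C < n) where
    open Cycle C using (vertex)

    private
      On : Fin n → Set
      On w = ∃[ k ] w ≡ vertex k

      on? : ∀ w → Dec (On w)
      on? w = any? (λ k → w Fin.≟ vertex k)

      not-spanning : ¬ (∀ w → On w)
      not-spanning onto with i , j , i<j , eq ← pigeonhole len<n (proj₁ ∘ onto) =
        Fin.<⇒≢ i<j (trans (proj₂ (onto i)) (trans (cong vertex eq) (sym (proj₂ (onto j)))))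

    -- By pigeonhole the cycle misses some vertex `w`; a walk from `w` to the cycle has a first edge
    -- that enters it.
    attached-vertex : ∃₂ λ u k → (∀ i → u ≢ vertex i) × u ~ vertex k
    attached-vertex
      with w , w∉ ← ¬∀⟶∃¬ n On on? not-spanning
      with u , _ , u∉ , (k , refl) , u~ ← leave On on? (conn w (vertex fzero)) w∉ (fzero , refl)
         = u , k , (λ i eq → u∉ (i , eq)) , u~

  attached-circuit : Connected G → ∀ {m} → IsGirth G (suc (suc m)) → suc (suc m) < n →
                     ∃₂ λ u f → Circuit (suc m) f × Avoids u (suc m) f × u ~ f 0
  attached-circuit conn ((C , refl) , _) g<n
    with u , k , u∉ , u~ ← attached-vertex conn C g<n
    with d , eq ← ℕ.m≤n⇒∃[o]m+o≡n (ℕ.≤-pred (toℕ<n k))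
    with f , rest ← rotate-to d (toℕ k) (trans (ℕ.+-comm d (toℕ k)) eq) (cycle⇒circuit C)
                      (λ _ → u∉ _) (subst (λ i → u ~ Cycle.vertex C i) (sym (mod-toℕ k)) u~)
       = u , f , rest

  -- Switching functions and the signs of cycles

  module _ (θ : Fin n → Sign) (ε : Sign)
           (switched : ∀ {i j} (p : i ~ j) → σ p ≡ ε Sign.* (θ i Sign.* θ j)) where

    -- Telescoping: every inner vertex contributes its `θ` twice, so only the two ends and a power
    -- of `ε` survive. The seed `z` of the fold is where the sign of the closing edge of a cycle
    -- goes.
    walk-sign : ∀ m (v : Fin (suc m) → Fin n) (e : ∀ k → v (inject₁ k) ~ v (fsuc k)) z →
                foldr Sign._*_ z (λ k → σ (e k)) ≡
                ε ^ˢ m Sign.* (θ (v fzero) Sign.* (θ (v (fromℕ m)) Sign.* z))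
    walk-sign zero    v e z = begin
      z                     ≡⟨ cong (Sign._* z) (Sign.s*s≡+ t) ⟨
      (t Sign.* t) Sign.* z ≡⟨ Sign.*-assoc t t z ⟩
      t Sign.* (t Sign.* z) ∎
      where
      open ≡-Reasoning
      t = θ (v fzero)
    walk-sign (suc m) v e z = trans
      (cong₂ Sign._*_ (switched (e fzero)) (walk-sign m (v ∘ fsuc) (e ∘ fsuc) z))
      (lemma ε (ε ^ˢ m) (θ (v fzero)) (θ (v (fsuc fzero))) _)
      where
      lemma : ∀ e f a b w → (e Sign.* (a Sign.* b)) Sign.* (f Sign.* (b Sign.* w)) ≡
              (e Sign.* f) Sign.* (a Sign.* w)
      lemma e f a b w = begin
        (e Sign.* (a Sign.* b)) Sign.* (f Sign.* (b Sign.* w))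
          ≡⟨ solve 5 (λ e f a b w → (e ⊕ (a ⊕ b)) ⊕ (f ⊕ (b ⊕ w)) ⊜ (b ⊕ b) ⊕ ((e ⊕ f) ⊕ (a ⊕ w)))
               refl e f a b w ⟩
        (b Sign.* b) Sign.* ((e Sign.* f) Sign.* (a Sign.* w))
          ≡⟨ cong (Sign._* _) (Sign.s*s≡+ b) ⟩
        (e Sign.* f) Sign.* (a Sign.* w) ∎
        where
        open ≡-Reasoning
        open import Algebra.Solver.CommutativeMonoid Sign.*-commutativeMonoid

    cycle-sign : ∀ (C : Cycle G) → Cycle.sign C ≡ ε ^ˢ Cycle.length C
    cycle-sign C = begin
      sign ≡⟨ walk-sign m vertex edge (σ closing) ⟩
      ε ^ˢ m Sign.* (a Sign.* (b Sign.* σ closing))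
        ≡⟨ cong (λ s → ε ^ˢ m Sign.* (a Sign.* (b Sign.* s))) (switched closing) ⟩
      ε ^ˢ m Sign.* (a Sign.* (b Sign.* (ε Sign.* (b Sign.* a))))
        ≡⟨ solve 4 (λ p a b e → p ⊕ (a ⊕ (b ⊕ (e ⊕ (b ⊕ a)))) ⊜ (a ⊕ a) ⊕ ((b ⊕ b) ⊕ (e ⊕ p)))
             refl (ε ^ˢ m) a b ε ⟩
      (a Sign.* a) Sign.* ((b Sign.* b) Sign.* (ε Sign.* ε ^ˢ m))
        ≡⟨ cong₂ (λ s t → s Sign.* (t Sign.* (ε Sign.* ε ^ˢ m))) (Sign.s*s≡+ a) (Sign.s*s≡+ b) ⟩
      ε ^ˢ length ∎
      where
      open ≡-Reasoning
      open import Algebra.Solver.CommutativeMonoid Sign.*-commutativeMonoid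
      open Cycle C
      a = θ (vertex fzero)
      b = θ (vertex (fromℕ m))

  switched⇒balanced : (θ : Fin n → Sign) →
    (∀ {i j} (p : i ~ j) → σ p ≡ θ i Sign.* θ j) → Balanced G
  switched⇒balanced θ switched C =
    trans (cycle-sign θ Sign.+ switched C) (+^ˢ (Cycle.length C))

  switched⇒antibalanced : (θ : Fin n → Sign) →
    (∀ {i j} (p : i ~ j) → σ p ≡ Sign.- Sign.* (θ i Sign.* θ j)) → Antibalanced G
  switched⇒antibalanced θ switched C = even , odd
    where
    eq : Cycle.sign C ≡ Sign.- ^ˢ Cycle.length C
    eq = cycle-sign θ Sign.- switched C
    even : 2 ∣ Cycle.length C → Cycle.sign C ≡ Sign.+
    even (divides q len) = trans eq (trans (cong (Sign.- ^ˢ_) len) (-^ˢ-even q))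
    odd : ¬ 2 ∣ Cycle.length C → Cycle.sign C ≡ Sign.-
    odd 2∤len = trans eq (-^ˢ-odd (Cycle.length C) 2∤len)

-- Rank over an ordered field

module LinearAlgebra {c ℓ : Level} (ℝ : CompleteOrderedField c ℓ) where
  open CompleteOrderedField ℝ
  open IsDecTotalOrder isDecTotalOrder
    using (antisym; total; ≤-respʳ-≈; ≤-respˡ-≈; module Eq)
    renaming (_≟_ to _≈?_)
  open Spectral ℝ
  open Algebra.Properties.Ring ring
  open Algebra.Properties.Semiring.Sum semiring
  open Algebra.Solver.Ring.NaturalCoefficients.Default commutativeSemiring
    using (solve; _:+_; _:*_; _:=_; con)

  ≈-setoid : Setoid c ℓ
  ≈-setoid = record { isEquivalence = IsDecTotalOrder.isEquivalence isDecTotalOrder }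

  open Relation.Binary.Reasoning.Setoid ≈-setoid

  -- Multiply by the inverse of `p - q`. In this two-sided form a nonzero determinant can be given
  -- as two unequal products, without subtraction.
  cancel-≉ : ∀ {p q x} → ¬ p ≈ q → p * x ≈ q * x → x ≈ 0#
  cancel-≉ {p} {q} {x} p≉q px≈qx with y , [p-q]y≈1 ← inverse (p - q) (p≉q ∘ x∙y⁻¹≈ε⇒x≈y p q) = begin
    x                 ≈⟨ *-identityˡ x ⟨
    1# * x            ≈⟨ *-congʳ [p-q]y≈1 ⟨
    (p - q) * y * x   ≈⟨ solve 3 (λ d y x → d :* y :* x := y :* (d :* x)) Eq.refl (p - q) y x ⟩
    y * ((p - q) * x) ≈⟨ *-congˡ ([y-z]x≈yx-zx x p q) ⟩
    y * (p * x - q * x) ≈⟨ *-congˡ (x≈y⇒x∙y⁻¹≈ε px≈qx) ⟩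
    y * 0#            ≈⟨ zeroʳ y ⟩
    0#                ∎

  *-cancel-0 : ∀ {p x} → ¬ p ≈ 0# → p * x ≈ 0# → x ≈ 0#
  *-cancel-0 {p} {x} p≉0 px≈0 = cancel-≉ p≉0 (Eq.trans px≈0 (Eq.sym (zeroˡ x)))

  1≉0 : ¬ 1# ≈ 0#
  1≉0 = 0≉1 ∘ Eq.sym

  -- The order excludes characteristic two: if 1 = -1, adding 1 to either of 0 ≤ 1 and 1 ≤ 0 yields
  -- the other.
  1≉-1 : ¬ 1# ≈ - 1#
  1≉-1 1≈-1 = 0≉1 (antisym (proj₁ 0≤1≤0) (proj₂ 0≤1≤0))
    where
    0≤1≤0 : 0# ≤ 1# × 1# ≤ 0#
    0≤1≤0 with total 0# 1#
    ... | inj₁ 0≤1 = 0≤1 , ≤-respˡ-≈ (+-identityʳ 1#)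
                       (≤-respʳ-≈ (Eq.trans (+-congˡ 1≈-1) (-‿inverseʳ 1#)) (+-monoʳ-≤ 1# 0≤1))
    ... | inj₂ 1≤0 = ≤-respˡ-≈ (Eq.trans (+-congˡ 1≈-1) (-‿inverseʳ 1#))
                       (≤-respʳ-≈ (+-identityʳ 1#) (+-monoʳ-≤ 1# 1≤0)) , 1≤0

  -1*-1≈1 : - 1# * - 1# ≈ 1#
  -1*-1≈1 = Eq.trans (-1*x≈-x (- 1#)) (-‿involutive 1#)

  signValue-* : ∀ s t → signValue (s Sign.* t) ≈ signValue s * signValue t
  signValue-* Sign.+ t      = Eq.sym (*-identityˡ _)
  signValue-* Sign.- Sign.+ = Eq.sym (*-identityʳ _)
  signValue-* Sign.- Sign.- = Eq.sym -1*-1≈1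

  signValue-injective : ∀ {s t} → signValue s ≈ signValue t → s ≡ t
  signValue-injective {Sign.+} {Sign.+} _  = refl
  signValue-injective {Sign.+} {Sign.-} eq = contradiction eq 1≉-1
  signValue-injective {Sign.-} {Sign.+} eq = contradiction (Eq.sym eq) 1≉-1
  signValue-injective {Sign.-} {Sign.-} _  = refl

  signValue-opposite : ∀ s → signValue (Sign.opposite s) ≈ - signValue s
  signValue-opposite Sign.+ = Eq.refl
  signValue-opposite Sign.- = Eq.sym (-‿involutive 1#)

  signValue≉0 : ∀ s → ¬ signValue s ≈ 0#
  signValue≉0 Sign.+ = 1≉0
  signValue≉0 Sign.- eq = 1≉0 (Eq.trans (Eq.sym (-‿involutive 1#)) (Eq.trans (-‿cong eq) -0#≈0#))

  square≈1⇒sign : ∀ {x} → x * x ≈ 1# → ∃[ s ] x ≈ signValue s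
  square≈1⇒sign {x} xx≈1 with x ≈? 1#
  ... | yes x≈1 = Sign.+ , x≈1
  ... | no  x≉1 = Sign.- , +-inverseˡ-unique x 1# (cancel-≉ x≉1 (begin
    x * (x + 1#)  ≈⟨ distribˡ x x 1# ⟩
    x * x + x * 1# ≈⟨ +-cong xx≈1 (*-identityʳ x) ⟩
    1# + x        ≈⟨ +-comm 1# x ⟩
    x + 1#        ≈⟨ *-identityˡ (x + 1#) ⟨
    1# * (x + 1#) ∎))

  sum-zero : ∀ {n} {f : Fin n → Carrier} → (∀ j → f j ≈ 0#) → sum f ≈ 0#
  sum-zero {n} f≈0 = Eq.trans (sum-cong-≋ f≈0) (sum-replicate-zero n)

  -- Zeroing an entry instead of deleting it keeps the index type, so that entries can be peeled off
  -- one after another.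
  except : ∀ {n} → Fin n → (Fin n → Carrier) → Fin n → Carrier
  except a f j with j Fin.≟ a
  ... | yes _ = 0#
  ... | no  _ = f j

  except-≡ : ∀ {n} (a : Fin n) f → except a f a ≡ 0#
  except-≡ a f with a Fin.≟ a
  ... | yes _  = refl
  ... | no a≢a = contradiction refl a≢a

  except-≢ : ∀ {n} {a j : Fin n} f → j ≢ a → except a f j ≡ f j
  except-≢ {a = a} {j} f j≢a with j Fin.≟ a
  ... | yes j≡a = contradiction j≡a j≢a
  ... | no _    = refl

  sum-except : ∀ {n} (f : Fin n → Carrier) a → sum f ≈ f a + sum (except a f)
  sum-except {suc n} f a = begin
    sum f                                         ≈⟨ sum-remove {i = a} f ⟩
    f a + sum (Vector.removeAt f a)               ≈⟨ +-congˡ (sum-cong-≋ λ j →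
                                                       Eq.reflexive (except-≢ f (Fin.punchInᵢ≢i a j))) ⟨
    f a + sum (Vector.removeAt (except a f) a)    ≈⟨ +-congˡ (+-identityˡ _) ⟨
    f a + (0# + sum (Vector.removeAt (except a f) a))
      ≈⟨ +-congˡ (+-congʳ (Eq.reflexive (except-≡ a f))) ⟨
    f a + (except a f a + sum (Vector.removeAt (except a f) a))
      ≈⟨ +-congˡ (sum-remove {i = a} (except a f)) ⟨
    f a + sum (except a f)                        ∎

  sum-support : ∀ {n k} (f : Fin n → Carrier) (c : Fin k → Fin n) → Injective _≡_ _≡_ c →
                (∀ j → (∀ t → j ≢ c t) → f j ≈ 0#) → sum f ≈ sum (f ∘ c)
  sum-support {k = zero}  f c inj f≈0 = sum-zero (λ j → f≈0 j λ ())
  sum-support {k = suc k} f c inj f≈0 = begin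
    sum f                          ≈⟨ sum-except f (c fzero) ⟩
    f (c fzero) + sum f′
      ≈⟨ +-congˡ (sum-support f′ (c ∘ fsuc) (Fin.suc-injective ∘ inj) f′≈0) ⟩
    f (c fzero) + sum (f′ ∘ c ∘ fsuc)
      ≈⟨ +-congˡ (sum-cong-≋ λ t →
           Eq.reflexive (except-≢ {j = c (fsuc t)} f (λ eq → Fin.0≢1+n (sym (inj eq))))) ⟩
    sum (f ∘ c)                    ∎
    where
    f′ = except (c fzero) f
    f′≈0 : ∀ j → (∀ t → j ≢ c (fsuc t)) → f′ j ≈ 0#
    f′≈0 j j∉ with j Fin.≟ c fzero
    ... | yes _  = Eq.refl
    ... | no j≢₀ = f≈0 j λ { fzero → j≢₀ ; (fsuc t) → j∉ t }

  sum-single : ∀ {n} (f : Fin n → Carrier) a → (∀ j → j ≢ a → f j ≈ 0#) → sum f ≈ f a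
  sum-single f a f≈0 = Eq.trans
    (sum-support f (a Vector.∷ Vector.[]) (∷-injective (λ ()) []-injective)
      (λ j j∉ → f≈0 j (j∉ fzero)))
    (+-identityʳ (f a))

  sum-pair : ∀ {n} (f : Fin n → Carrier) {a b} → a ≢ b →
             (∀ j → j ≢ a → j ≢ b → f j ≈ 0#) → sum f ≈ f a + f b
  sum-pair f {a} {b} a≢b f≈0 = Eq.trans
    (sum-support f (a Vector.∷ b Vector.∷ Vector.[]) (pair-injective a≢b)
      (λ j j∉ → f≈0 j (j∉ fzero) (j∉ (fsuc fzero))))
    (+-congˡ (+-identityʳ (f b)))

  -- Free families of columns and the rank

  Free : ∀ {m n k} → Matrix m n → (Fin k → Fin n) → Set (c ⊔ ℓ)
  Free {k = k} M col =
    ∀ (z : Fin k → Carrier) → (∀ i → sum (λ t → M i (col t) * z t) ≈ 0#) → ∀ t → z t ≈ 0#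

  ·-support : ∀ {m n k} (M : Matrix m n) (col : Fin k → Fin n) → Injective _≡_ _≡_ col → ∀ x →
              (∀ j → (∀ t → j ≢ col t) → x j ≈ 0#) →
              ∀ i → (M · x) i ≈ sum (λ t → M i (col t) * x (col t))
  ·-support M col inj x x≈0 i =
    sum-support _ col inj λ j j∉ → Eq.trans (*-congˡ (x≈0 j j∉)) (zeroʳ _)

  free⇒≤rank : ∀ {m n k r} {M : Matrix m n} → IsRank M r → (col : Fin k → Fin n) →
               Injective _≡_ _≡_ col → Free M col → k ℕ.≤ r
  free⇒≤rank {M = M} (_ , maximal) col inj free =
    ℕ.≤-trans (∣image∣ col inj) (maximal (image col) independent)
    where
    independent : IndependentColumns M (image col)
    independent x x≈0 Mx≈0 j with any? (λ t → j Fin.≟ col t)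
    ... | no  j∉         = x≈0 j (j∉ ∘ ∈-image⁻ col)
    ... | yes (t , refl) = free (x ∘ col)
      (λ i → Eq.trans (Eq.sym (·-support M col inj x
        (λ j j∉ → x≈0 j λ j∈ → let t , eq = ∈-image⁻ col j∈ in j∉ t eq) i)) (Mx≈0 i)) t

  -- An independent set with more than `k` columns contains `suc k` listed ones, and these are free:
  -- a relation among them, extended by zero, is a relation supported on the set.
  rank≤ : ∀ {m n r} {M : Matrix m n} → IsRank M r → ∀ k →
          (∀ (col : Fin (suc k) → Fin n) → Injective _≡_ _≡_ col → ¬ Free M col) → r ℕ.≤ k
  rank≤ {n = n} {r} {M} ((S , independent , ∣S∣≡r) , _) k dependent = ℕ.≮⇒≥ λ k<r →
    let col , inj , col∈ = select (suc k) S (subst (suc k ℕ.≤_) (sym ∣S∣≡r) k<r)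
    in dependent col inj (free col inj col∈)
    where
    module _ (col : Fin (suc k) → Fin n) (inj : Injective _≡_ _≡_ col) (col∈ : ∀ t → col t ∈ S) where
      extend : (Fin (suc k) → Carrier) → Fin n → Carrier
      extend z j with any? (λ t → j Fin.≟ col t)
      ... | yes (t , _) = z t
      ... | no  _       = 0#

      extend-col : ∀ z t → extend z (col t) ≡ z t
      extend-col z t with any? (λ s → col t Fin.≟ col s)
      ... | yes (s , eq) = cong z (sym (inj eq))
      ... | no  ∉        = contradiction (t , refl) ∉

      extend-off : ∀ z j → (∀ t → j ≢ col t) → extend z j ≈ 0#
      extend-off z j j∉ with any? (λ t → j Fin.≟ col t)
      ... | yes (t , eq) = contradiction eq (j∉ t)
      ... | no  _        = Eq.refl

      free : Free M col
      free z Mz≈0 t = Eq.trans (Eq.sym (Eq.reflexive (extend-col z t)))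
        (independent (extend z)
          (λ j j∉S → extend-off z j λ { t refl → j∉S (col∈ t) })
          (λ i → Eq.trans (·-support M col inj (extend z) (extend-off z) i)
            (Eq.trans (sum-cong-≋ λ t → *-congˡ {M i (col t)} (Eq.reflexive (extend-col z t))) (Mz≈0 i)))
          (col t))

  -- Strong induction on the index: in row `t` the later columns have zero entries and the earlier
  -- coefficients are already known to vanish, which leaves the diagonal term.
  triangular⇒free : ∀ {m n k} (M : Matrix m n) (row : Fin k → Fin m) (col : Fin k → Fin n) →
                    (∀ i → ¬ M (row i) (col i) ≈ 0#) →
                    (∀ {i t} → i Fin.< t → M (row i) (col t) ≈ 0#) → Free M col
  triangular⇒free M row col diagonal upper z Mz≈0 t = below (suc (toℕ t)) t ℕ.≤-refl
    where
    below : ∀ b t → toℕ t ℕ.< b → z t ≈ 0#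
    below (suc b) t (s≤s t≤b) = *-cancel-0 (diagonal t)
      (Eq.trans (Eq.sym (sum-single _ t vanish)) (Mz≈0 (row t)))
      where
      vanish : ∀ j → j ≢ t → M (row t) (col j) * z j ≈ 0#
      vanish j j≢t with Fin.<-cmp j t
      ... | tri< j<t _ _ = Eq.trans (*-congˡ (below b j (ℕ.<-≤-trans j<t t≤b))) (zeroʳ _)
      ... | tri≈ _ j≡t _ = contradiction j≡t j≢t
      ... | tri> _ _ t<j = Eq.trans (*-congʳ (upper t<j)) (zeroˡ _)

  -- A relation between two of the columns, padded with zeros, is a nontrivial relation of the whole
  -- family.
  relation⇒¬free : ∀ {m n k} (M : Matrix m n) (col : Fin k → Fin n) {s t} → s ≢ t →
                   ∀ {u w} → ¬ u ≈ 0# → (∀ i → M i (col s) * u + M i (col t) * w ≈ 0#) → ¬ Free M col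
  relation⇒¬free {k = k} M col {s} {t} s≢t {u} {w} u≉0 relation free =
    u≉0 (Eq.trans (Eq.sym (Eq.reflexive z-s)) (free z Mz≈0 s))
    where
    z : Fin k → Carrier
    z j with j Fin.≟ s
    ... | yes _ = u
    ... | no  _ = except′ j
      where
      except′ : Fin k → Carrier
      except′ j with j Fin.≟ t
      ... | yes _ = w
      ... | no  _ = 0#
    z-s : z s ≡ u
    z-s with s Fin.≟ s
    ... | yes _  = refl
    ... | no s≢s = contradiction refl s≢s
    z-t : z t ≡ w
    z-t with t Fin.≟ s
    ... | yes t≡s = contradiction (sym t≡s) s≢t
    ... | no  _ with t Fin.≟ t
    ...   | yes _  = refl
    ...   | no t≢t = contradiction refl t≢t
    z-off : ∀ j → j ≢ s → j ≢ t → z j ≈ 0#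
    z-off j j≢s j≢t with j Fin.≟ s
    ... | yes j≡s = contradiction j≡s j≢s
    ... | no  _ with j Fin.≟ t
    ...   | yes j≡t = contradiction j≡t j≢t
    ...   | no  _   = Eq.refl
    Mz≈0 : ∀ i → sum (λ j → M i (col j) * z j) ≈ 0#
    Mz≈0 i = Eq.trans
      (sum-pair _ s≢t λ j j≢s j≢t → Eq.trans (*-congˡ (z-off j j≢s j≢t)) (zeroʳ _))
      (Eq.trans (+-cong (*-congˡ (Eq.reflexive z-s)) (*-congˡ (Eq.reflexive z-t))) (relation i))

  -- Cramer's rule, contraposed: a nonzero minor in rows `i` and `j` would make the two columns
  -- free. Decidable equality removes the double negation.
  minors-vanish : ∀ {m n} (M : Matrix m n) {a b} → ¬ Free M (a Vector.∷ b Vector.∷ Vector.[]) →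
                  ∀ i j → M i a * M j b ≈ M i b * M j a
  minors-vanish M {a} {b} ¬free i j = decidable-stable (_ ≈? _) λ minor≉0 → ¬free λ z Mz≈0 →
    let p = M i a ; q = M i b ; r = M j a ; s = M j b
        x = z fzero ; y = z (fsuc fzero)
        eqᵢ : p * x + q * y ≈ 0#
        eqᵢ = Eq.trans (+-congˡ (Eq.sym (+-identityʳ _))) (Mz≈0 i)
        eqⱼ : r * x + s * y ≈ 0#
        eqⱼ = Eq.trans (+-congˡ (Eq.sym (+-identityʳ _))) (Mz≈0 j)
        x≈0 : x ≈ 0#
        -- Elimination of `y` from the two equations, with `q * s * y` added to both sides in place
        -- of a subtraction.
        x≈0 = cancel-≉ minor≉0 (+-cancelʳ (q * s * y) _ _ (begin
          p * s * x + q * s * y ≈⟨ solve 5 (λ p q s x y → p :* s :* x :+ q :* s :* y :=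
                                      s :* (p :* x :+ q :* y)) Eq.refl p q s x y ⟩
          s * (p * x + q * y)   ≈⟨ Eq.trans (*-congˡ eqᵢ) (zeroʳ s) ⟩
          0#                    ≈⟨ Eq.trans (*-congˡ eqⱼ) (zeroʳ q) ⟨
          q * (r * x + s * y)   ≈⟨ solve 5 (λ q r s x y → q :* (r :* x :+ s :* y) :=
                                      q :* r :* x :+ q :* s :* y) Eq.refl q r s x y ⟩
          q * r * x + q * s * y ∎))
        y≈0 : y ≈ 0#
        y≈0 = cancel-≉ minor≉0 (+-cancelʳ (p * r * x) _ _ (begin
          p * s * y + p * r * x ≈⟨ solve 5 (λ p r s x y → p :* s :* y :+ p :* r :* x :=
                                      p :* (r :* x :+ s :* y)) Eq.refl p r s x y ⟩
          p * (r * x + s * y)   ≈⟨ Eq.trans (*-congˡ eqⱼ) (zeroʳ p) ⟩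
          0#                    ≈⟨ Eq.trans (*-congˡ eqᵢ) (zeroʳ r) ⟨
          r * (p * x + q * y)   ≈⟨ solve 5 (λ p q r x y → r :* (p :* x :+ q :* y) :=
                                      q :* r :* y :+ p :* r :* x) Eq.refl p q r x y ⟩
          q * r * y + p * r * x ∎))
    in λ { fzero → x≈0 ; (fsuc fzero) → y≈0 }

  -- The Schur complement of the block on {x , y}, whose diagonal is zero.
  schur-vanishes : ∀ {n} (M : Matrix n n) {x y j} → M x x ≈ 0# → M y y ≈ 0# → M y x ≈ M x y →
                   ¬ M x y ≈ 0# → ¬ Free M (x Vector.∷ y Vector.∷ j Vector.∷ Vector.[]) →
                   ∀ i → M x y * M i j ≈ M i x * M y j + M i y * M x j
  schur-vanishes M {x} {y} {j} Mxx≈0 Myy≈0 Myx≈Mxy Mxy≉0 ¬free i =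
    decidable-stable (_ ≈? _) λ schur≉0 → ¬free λ z Mz≈0 →
      let s = M x y ; a = M i x ; b = M i y ; d = M i j ; q = M x j ; r = M y j
          u = z fzero ; v = z (fsuc fzero) ; w = z (fsuc (fsuc fzero))
          row-x : s * v + q * w ≈ 0#
          row-x = begin
            s * v + q * w                         ≈⟨ +-identityˡ _ ⟨
            0# + (s * v + q * w)
              ≈⟨ +-cong (Eq.trans (*-congʳ Mxx≈0) (zeroˡ u)) (+-congˡ (+-identityʳ _)) ⟨
            M x x * u + (s * v + (q * w + 0#))    ≈⟨ Mz≈0 x ⟩
            0#                                    ∎
          row-y : s * u + r * w ≈ 0#
          row-y = begin
            s * u + r * w                             ≈⟨ +-congˡ (+-identityˡ _) ⟨
            s * u + (0# + r * w)
              ≈⟨ +-cong (*-congʳ Myx≈Mxy)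
                   (+-cong (Eq.trans (*-congʳ Myy≈0) (zeroˡ v)) (+-identityʳ _)) ⟨
            M y x * u + (M y y * v + (r * w + 0#))    ≈⟨ Mz≈0 y ⟩
            0#                                        ∎
          -- Taking `a` times `row-y` and `b` times `row-x` from `s` times row `i` eliminates `u`
          -- and `v`; the coefficient of `w` that remains is the Schur complement.
          w≈0 : w ≈ 0#
          w≈0 = cancel-≉ schur≉0 (+-cancelʳ (a * (s * u) + b * (s * v)) _ _ (begin
            s * d * w + (a * (s * u) + b * (s * v))
              ≈⟨ solve 7 (λ s d w a u b v → s :* d :* w :+ (a :* (s :* u) :+ b :* (s :* v)) :=
                   s :* (a :* u :+ (b :* v :+ (d :* w :+ con 0)))) Eq.refl s d w a u b v ⟩
            s * (a * u + (b * v + (d * w + 0#))) ≈⟨ Eq.trans (*-congˡ (Mz≈0 i)) (zeroʳ s) ⟩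
            0#                                   ≈⟨ +-identityʳ 0# ⟨
            0# + 0#                              ≈⟨ +-cong (Eq.trans (*-congˡ row-y) (zeroʳ a))
                                                           (Eq.trans (*-congˡ row-x) (zeroʳ b)) ⟨
            a * (s * u + r * w) + b * (s * v + q * w)
              ≈⟨ solve 8 (λ s w a u b v q r → a :* (s :* u :+ r :* w) :+ b :* (s :* v :+ q :* w) :=
                   (a :* r :+ b :* q) :* w :+ (a :* (s :* u) :+ b :* (s :* v)))
                   Eq.refl s w a u b v q r ⟩
            (a * r + b * q) * w + (a * (s * u) + b * (s * v)) ∎))
          su≈0 : s * u ≈ 0#
          su≈0 = Eq.trans (Eq.sym (Eq.trans (+-congˡ (Eq.trans (*-congˡ w≈0) (zeroʳ r)))
                     (+-identityʳ _))) row-y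
          sv≈0 : s * v ≈ 0#
          sv≈0 = Eq.trans (Eq.sym (Eq.trans (+-congˡ (Eq.trans (*-congˡ w≈0) (zeroʳ q)))
                     (+-identityʳ _))) row-x
      in λ { fzero → *-cancel-0 Mxy≉0 su≈0 ; (fsuc fzero) → *-cancel-0 Mxy≉0 sv≈0
           ; (fsuc (fsuc fzero)) → w≈0 }

-- The spectrum of a signed graph

separate : ∀ {n} {P : Fin n → Set} → (∀ i → Dec (P i)) → Subset n
separate P? = tabulate (does ∘ P?)

∈-separate⁺ : ∀ {n} {P : Fin n → Set} (P? : ∀ i → Dec (P i)) {i} → P i → i ∈ separate P?
∈-separate⁺ P? {i} Pi =
  lookup⇒[]= i _ (trans (lookup∘tabulate (does ∘ P?) i) (dec-true (P? i) Pi))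

∈-separate⁻ : ∀ {n} {P : Fin n → Set} (P? : ∀ i → Dec (P i)) {i} → i ∈ separate P? → P i
∈-separate⁻ P? {i} i∈ with P? i | trans (sym (lookup∘tabulate (does ∘ P?) i)) ([]=⇒lookup i∈)
... | yes Pi | _ = Pi

two-elements : ∀ {n} {S : Subset n} {a b} → a ≢ b → a ∈ S → b ∈ S → 2 ℕ.≤ ∣ S ∣
two-elements {S = S} {a} {b} a≢b a∈S b∈S =
  ℕ.≤-trans (∣image∣ pair (pair-injective a≢b)) (p⊆q⇒∣p∣≤∣q∣ (within ∘ ∈-image⁻ pair))
  where
  pair : Fin 2 → Fin _
  pair = a Vector.∷ b Vector.∷ Vector.[]
  within : ∀ {j} → ∃[ t ] j ≡ pair t → j ∈ S
  within (fzero , refl)      = a∈S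
  within (fsuc fzero , refl) = b∈S

-- Sign identities for triangles and squares

opposite-* : ∀ s t → Sign.opposite s Sign.* t ≡ Sign.opposite (s Sign.* t)
opposite-* Sign.+ t = refl
opposite-* Sign.- t = sym (Sign.opposite-involutive t)

*-opposite : ∀ s t → s Sign.* Sign.opposite t ≡ Sign.opposite (s Sign.* t)
*-opposite Sign.+ t = refl
*-opposite Sign.- t = refl

opposite-*-opposite : ∀ s t → Sign.opposite s Sign.* Sign.opposite t ≡ s Sign.* t
opposite-*-opposite s t = trans (opposite-* s _)
  (trans (cong Sign.opposite (*-opposite s t)) (Sign.opposite-involutive _))

*-movesˡ : ∀ s {t u} → s Sign.* t ≡ u → t ≡ s Sign.* u
*-movesˡ s {t} refl = trans (sym (cong (Sign._* t) (Sign.s*s≡+ s))) (Sign.*-assoc s s t)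

diagonal-sign : ∀ δ s → δ ≡ Sign.opposite (Sign.opposite s Sign.* (δ Sign.* s))
diagonal-sign Sign.+ Sign.+ = refl
diagonal-sign Sign.+ Sign.- = refl
diagonal-sign Sign.- Sign.+ = refl
diagonal-sign Sign.- Sign.- = refl

-- For `s`, `t`, `u` the signs of the edges ia, ab, bi, this makes the entries of columns a and b in
-- a third row i proportional with a factor independent of i.
triangle-signs : ∀ δ s t u → s Sign.* (t Sign.* u) ≡ Sign.opposite δ →
                 s ≡ Sign.opposite u Sign.* (δ Sign.* t)
triangle-signs δ s t u eq = begin
  s                                         ≡⟨ *-movesˡ (t Sign.* u) (trans (Sign.*-comm _ s) eq) ⟩
  (t Sign.* u) Sign.* Sign.opposite δ       ≡⟨ *-opposite (t Sign.* u) δ ⟩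
  Sign.opposite ((t Sign.* u) Sign.* δ)     ≡⟨ cong Sign.opposite
                                                 (solve 3 (λ t u d → (t ⊕ u) ⊕ d ⊜ u ⊕ (d ⊕ t)) refl t u δ) ⟩
  Sign.opposite (u Sign.* (δ Sign.* t))     ≡⟨ opposite-* u (δ Sign.* t) ⟨
  Sign.opposite u Sign.* (δ Sign.* t)       ∎
  where
  open ≡-Reasoning
  open import Algebra.Solver.CommutativeMonoid Sign.*-commutativeMonoid

-- Here `s`, `t`, `u`, `v` are the signs of ia, ob, oa, ib in a square with opposite corners a, b
-- and i, o. The conclusion makes a fixed combination of columns a and b vanish in row i.
square-signs : ∀ s t u v → s Sign.* (u Sign.* (t Sign.* v)) ≡ Sign.+ →
               Sign.opposite s Sign.* t ≡ Sign.opposite (Sign.opposite v Sign.* Sign.opposite u)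
square-signs s t u v eq = begin
  Sign.opposite s Sign.* t       ≡⟨ opposite-* s t ⟩
  Sign.opposite (s Sign.* t)     ≡⟨ cong Sign.opposite (*-movesˡ (v Sign.* u) (trans
    (solve 4 (λ s t u v → (v ⊕ u) ⊕ (s ⊕ t) ⊜ s ⊕ (u ⊕ (t ⊕ v))) refl s t u v) eq)) ⟩
  Sign.opposite ((v Sign.* u) Sign.* Sign.+) ≡⟨ cong Sign.opposite (Sign.*-identityʳ _) ⟩
  Sign.opposite (v Sign.* u)     ≡⟨ cong Sign.opposite (opposite-*-opposite v u) ⟨
  Sign.opposite (Sign.opposite v Sign.* Sign.opposite u) ∎
  where
  open ≡-Reasoning
  open import Algebra.Solver.CommutativeMonoid Sign.*-commutativeMonoid

module Spectrum {c ℓ : Level} (ℝ : CompleteOrderedField c ℓ) where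
  open CompleteOrderedField ℝ
  open IsDecTotalOrder isDecTotalOrder using (module Eq) renaming (_≟_ to _≈?_)
  open Spectral ℝ
  open LinearAlgebra ℝ
  open Algebra.Properties.Ring ring
  open Relation.Binary.Reasoning.Setoid ≈-setoid

  signs-cancel : ∀ α υ β ω → α Sign.* υ ≡ Sign.opposite (β Sign.* ω) →
                 signValue α * signValue υ + signValue β * signValue ω ≈ 0#
  signs-cancel α υ β ω eq = begin
    signValue α * signValue υ + signValue β * signValue ω
      ≈⟨ +-cong (signValue-* α υ) (signValue-* β ω) ⟨
    signValue (α Sign.* υ) + signValue (β Sign.* ω)
      ≈⟨ +-congʳ (Eq.reflexive (cong signValue eq)) ⟩
    signValue (Sign.opposite (β Sign.* ω)) + signValue (β Sign.* ω)
      ≈⟨ +-congʳ (signValue-opposite (β Sign.* ω)) ⟩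
    - signValue (β Sign.* ω) + signValue (β Sign.* ω)
      ≈⟨ -‿inverseˡ _ ⟩
    0# ∎

  -- `signValue` is an injective homomorphism, so an equation between products of matrix entries
  -- becomes one between signs.
  signs-agree : ∀ {w x y z} s t u v → w ≈ signValue s → x ≈ signValue t →
                y ≈ signValue u → z ≈ signValue v → w * x ≈ y * z → s Sign.* t ≡ u Sign.* v
  signs-agree {w} {x} {y} {z} s t u v w≈ x≈ y≈ z≈ wx≈yz = signValue-injective (begin
    signValue (s Sign.* t)    ≈⟨ signValue-* s t ⟩
    signValue s * signValue t ≈⟨ *-cong w≈ x≈ ⟨
    w * x                     ≈⟨ wx≈yz ⟩
    y * z                     ≈⟨ *-cong y≈ z≈ ⟩
    signValue u * signValue v ≈⟨ signValue-* u v ⟨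
    signValue (u Sign.* v)    ∎)

  signValue-square : ∀ s → signValue s * signValue s ≈ 1#
  signValue-square s = Eq.trans (Eq.sym (signValue-* s s)) (Eq.reflexive (cong signValue (Sign.s*s≡+ s)))

  -- The matrix of the eigenvalue problem and induced paths

  module _ {n : ℕ} (G : SignedGraph n) (μ : Carrier) where
    open SignedGraph G

    σ-irrelevant : ∀ {i j} (p q : i ~ j) → σ p ≡ σ q
    σ-irrelevant p q = trans (σ-sym p (~-sym p)) (sym (σ-sym q (~-sym p)))

    ~⇒≢ : ∀ {i j} → i ~ j → i ≢ j
    ~⇒≢ p i≡j = ~-irrefl i≡j p

    -- Opaque, so that case analyses on i ≟ j and i ~? j leave goals about M alone.
    abstract
      M : Matrix n n
      M i j = μ * identity i j - adjacency G i j

      multiplicity-rank : ∃[ r ] IsRank M r × multiplicity G μ ≡ n ℕ.∸ r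
      multiplicity-rank = rank M , rank-isRank M , refl

      M-diagonal : ∀ i → M i i ≈ μ
      M-diagonal i with i Fin.≟ i | i ~? i
      ... | no i≢i | _     = contradiction refl i≢i
      ... | yes _  | yes p = contradiction refl (~⇒≢ p)
      ... | yes _  | no  _ = Eq.trans (+-cong (*-identityʳ μ) -0#≈0#) (+-identityʳ μ)

      M-nonedge : ∀ {i j} → i ≢ j → ¬ i ~ j → M i j ≈ 0#
      M-nonedge {i} {j} i≢j i≁j with i Fin.≟ j | i ~? j
      ... | yes i≡j | _     = contradiction i≡j i≢j
      ... | no  _   | yes p = contradiction p i≁j
      ... | no  _   | no  _ = Eq.trans (+-cong (zeroʳ μ) -0#≈0#) (+-identityʳ 0#)

      M-edge : ∀ {i j} (p : i ~ j) → M i j ≈ signValue (Sign.opposite (σ p))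
      M-edge {i} {j} p with i Fin.≟ j | i ~? j
      ... | yes i≡j | _      = contradiction i≡j (~⇒≢ p)
      ... | no  _   | no i≁j = contradiction p i≁j
      ... | no  _   | yes q  = begin
        μ * 0# - signValue (σ q)      ≈⟨ Eq.trans (+-congʳ (zeroʳ μ)) (+-identityˡ _) ⟩
        - signValue (σ q)             ≈⟨ signValue-opposite (σ q) ⟨
        signValue (Sign.opposite (σ q)) ≈⟨ Eq.reflexive (cong (signValue ∘ Sign.opposite) (σ-irrelevant q p)) ⟩
        signValue (Sign.opposite (σ p)) ∎

    M-edge≉0 : ∀ {i j} → i ~ j → ¬ M i j ≈ 0#
    M-edge≉0 p Mij≈0 = signValue≉0 (Sign.opposite (σ p)) (Eq.trans (Eq.sym (M-edge p)) Mij≈0)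

    M-sym : ∀ i j → M i j ≈ M j i
    M-sym i j with i Fin.≟ j | i ~? j
    ... | yes refl | _      = Eq.refl
    ... | no i≢j   | no i≁j =
      Eq.trans (M-nonedge i≢j i≁j) (Eq.sym (M-nonedge (i≢j ∘ sym) (i≁j ∘ ~-sym)))
    ... | no _     | yes p  = begin
      M i j                                    ≈⟨ M-edge p ⟩
      signValue (Sign.opposite (σ p))
        ≈⟨ Eq.reflexive (cong (signValue ∘ Sign.opposite) (σ-sym p (~-sym p))) ⟩
      signValue (Sign.opposite (σ (~-sym p)))  ≈⟨ M-edge (~-sym p) ⟨
      M j i                                    ∎

    M-nonedge₀ : μ ≈ 0# → ∀ {i j} → ¬ i ~ j → M i j ≈ 0#
    M-nonedge₀ μ≈0 {i} {j} i≁j with i Fin.≟ j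
    ... | yes refl = Eq.trans (M-diagonal i) μ≈0
    ... | no  i≢j  = M-nonedge i≢j i≁j

    -- Rows p 0, ..., p (k - 1) against columns p 1, ..., p k: the diagonal consists of edges of the
    -- path, and an entry above it joins vertices at span at least 2, hence is zero. The entries `μ`
    -- lie below the diagonal, so the bound holds for every `μ`.
    induced-path≤rank : ∀ {k p r} → Path G k p → Chordless G k p → IsRank M r → k ℕ.≤ r
    induced-path≤rank {k} {p} P chordless isRank = free⇒≤rank isRank col
      (λ {s} {t} eq → Fin.toℕ-injective (ℕ.suc-injective (injective (Fin.toℕ<n s) (Fin.toℕ<n t) eq)))
      (triangular⇒free M (p ∘ toℕ) col (λ i → M-edge≉0 (step (Fin.toℕ<n i))) upper)
      where
      open Path P
      col : Fin k → Fin n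
      col t = p (suc (toℕ t))
      upper : ∀ {i t} → i Fin.< t → M (p (toℕ i)) (col t) ≈ 0#
      upper {i} {t} i<t with o , eq ← ℕ.m≤n⇒∃[o]m+o≡n i<t = M-nonedge
        (λ pᵢ≡pₜ → ℕ.<⇒≢ (ℕ.m≤n⇒m≤1+n i<t)
          (injective (ℕ.<⇒≤ (Fin.toℕ<n i)) (Fin.toℕ<n t) pᵢ≡pₜ))
        (subst (λ j → ¬ p (toℕ i) ~ p j) d≡
          (chordless (s≤s (s≤s z≤n)) (subst (ℕ._≤ k) (sym d≡) (Fin.toℕ<n t))))
        where
        d≡ : suc (suc o) ℕ.+ toℕ i ≡ suc (toℕ t)
        d≡ = cong suc (trans (cong suc (ℕ.+-comm o (toℕ i))) eq)

    -- Rank one: complete signed graphs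

    module RankOne (isRank : IsRank M 1) {x y : Fin n} (x~y : x ~ y) where

      minors : ∀ a b i j → M i a * M j b ≈ M i b * M j a
      minors a b i j with a Fin.≟ b
      ... | yes refl = Eq.refl
      ... | no  a≢b  = minors-vanish M
        (λ free → ℕ.1+n≰n (free⇒≤rank isRank _ (pair-injective a≢b) free)) i j

      μ²≈M² : ∀ i j → μ * μ ≈ M i j * M i j
      μ²≈M² i j = begin
        μ * μ         ≈⟨ *-cong (M-diagonal i) (M-diagonal j) ⟨
        M i i * M j j ≈⟨ minors i j i j ⟩
        M i j * M j i ≈⟨ *-congˡ (M-sym j i) ⟩
        M i j * M i j ∎

      μ²≈1 : μ * μ ≈ 1#
      μ²≈1 = begin
        μ * μ         ≈⟨ μ²≈M² x y ⟩
        M x y * M x y ≈⟨ *-cong (M-edge x~y) (M-edge x~y) ⟩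
        _             ≈⟨ signValue-square (Sign.opposite (σ x~y)) ⟩
        1#            ∎

      complete : IsComplete G
      complete i j i≢j = decidable-stable (i ~? j) λ i≁j → 1≉0 (begin
        1#            ≈⟨ μ²≈1 ⟨
        μ * μ         ≈⟨ μ²≈M² i j ⟩
        M i j * M i j ≈⟨ *-congˡ (M-nonedge i≢j i≁j) ⟩
        M i j * 0#    ≈⟨ zeroʳ _ ⟩
        0#            ∎)

      M-sign : ∀ i → ∃[ s ] M i x ≈ signValue s
      M-sign i = square≈1⇒sign (Eq.trans (Eq.sym (μ²≈M² i x)) μ²≈1)

      θ : Fin n → Sign
      θ i = proj₁ (M-sign i)

      -- The minor on rows `i`, `x` and columns `j`, `x` equates `M i j * M x x` with
      -- `M i x * M x j`, so column `x` serves as a switching function.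
      switched : ∀ {δ} → μ ≈ signValue δ → ∀ {i j} (p : i ~ j) →
                 Sign.opposite (σ p) Sign.* δ ≡ θ i Sign.* θ j
      switched {δ} μ≈δ {i} {j} p = signs-agree (Sign.opposite (σ p)) δ (θ i) (θ j)
        (M-edge p) (Eq.trans (M-diagonal x) μ≈δ) (proj₂ (M-sign i))
        (Eq.trans (M-sym x j) (proj₂ (M-sign j))) (minors j x i x)

      classify : (IsComplete G × Balanced G × μ ≈ - 1#) ⊎ (IsComplete G × Antibalanced G × μ ≈ 1#)
      classify with square≈1⇒sign μ²≈1
      -- A diagonal of -1 cancels the sign change from `A` to `M`, leaving all edges switched to
      -- `+`; a diagonal of 1 keeps it, leaving all edges switched to `-`.
      ... | Sign.- , μ≈-1 = inj₁ (complete , switched⇒balanced G θ (λ p →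
        trans (sym (trans (opposite-*-opposite (σ p) Sign.+) (Sign.*-identityʳ (σ p))))
          (switched μ≈-1 p)) , μ≈-1)
      ... | Sign.+ , μ≈1  = inj₂ (complete , switched⇒antibalanced G θ (λ p →
        trans (sym (Sign.opposite-involutive (σ p)))
          (cong Sign.opposite (trans (sym (Sign.*-identityʳ _)) (switched μ≈1 p)))) , μ≈1)

    has-neighbour : Connected G → ∀ {x y} → x ~ y → ∀ i → ∃[ j ] i ~ j
    has-neighbour conn {x} {y} x~y i with conn i x
    ... | nil   = y , x~y
    ... | p ◅ _ = _ , p

    -- Rank two: complete bipartite signed graphs

    module RankTwo (isRank : IsRank M 2) (conn : Connected G)
                   (triangle-free : ∀ {a b c} → a ~ b → b ~ c → ¬ c ~ a)
                   {f : ℕ → Fin n} (C : Circuit G 3 f) {u : Fin n} (u∉ : Avoids G u 3 f)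
                   (u~f₀ : u ~ f 0) (u~f₂ : u ~ f 2) where
      open Circuit C

      dependent : ∀ {a b c} → a ≢ b → a ≢ c → b ≢ c →
                  ¬ Free M (a Vector.∷ b Vector.∷ c Vector.∷ Vector.[])
      dependent a≢b a≢c b≢c free =
        ℕ.1+n≰n (free⇒≤rank isRank _ (triple-injective a≢b a≢c b≢c) free)

      0<3 : 0 ℕ.< 3
      0<3 = s≤s z≤n
      1<3 : 1 ℕ.< 3
      1<3 = s≤s (s≤s z≤n)

      x y : Fin n
      x = f 0
      y = f 1

      x~y : x ~ y
      x~y = step 0<3

      y~f₂ : y ~ f 2
      y~f₂ = step 1<3

      f₂~f₃ : f 2 ~ f 3
      f₂~f₃ = step ℕ.≤-refl

      y≢f₃ : y ≢ f 3
      y≢f₃ eq with () ← injective (ℕ.<⇒≤ 1<3) ℕ.≤-refl eq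

      x≢f₂ : x ≢ f 2
      x≢f₂ eq with () ← injective z≤n 1<3 eq

      f₃≁y : ¬ f 3 ~ y
      f₃≁y = triangle-free y~f₂ f₂~f₃

      -- f 1, f 3 and u are pairwise nonadjacent.
      μ≈0 : μ ≈ 0#
      μ≈0 = decidable-stable (μ ≈? 0#) λ μ≉0 → dependent y≢f₃ (u∉ (ℕ.<⇒≤ 1<3) ∘ sym) (u∉ ℕ.≤-refl ∘ sym)
        (triangular⇒free M v v (λ i Mii≈0 → μ≉0 (Eq.trans (Eq.sym (M-diagonal (v i))) Mii≈0)) upper)
        where
        v : Fin 3 → Fin n
        v = y Vector.∷ f 3 Vector.∷ u Vector.∷ Vector.[]
        upper : ∀ {i t} → i Fin.< t → M (v i) (v t) ≈ 0#
        upper {fzero}      {fsuc fzero}        _ = M-nonedge y≢f₃ (f₃≁y ∘ ~-sym)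
        upper {fzero}      {fsuc (fsuc fzero)} _ = M-nonedge (u∉ (ℕ.<⇒≤ 1<3) ∘ sym) (triangle-free u~f₀ x~y)
        upper {fsuc fzero} {fsuc (fsuc fzero)} _ = M-nonedge (u∉ ℕ.≤-refl ∘ sym) (triangle-free u~f₂ f₂~f₃)
        upper {fsuc fzero}        {fsuc fzero}        (s≤s ())
        upper {fsuc (fsuc fzero)} {fsuc fzero}        (s≤s ())
        upper {fsuc (fsuc fzero)} {fsuc (fsuc fzero)} (s≤s (s≤s ()))

      M-diagonal₀ : ∀ i → M i i ≈ 0#
      M-diagonal₀ i = Eq.trans (M-diagonal i) μ≈0

      schur : ∀ i j → M x y * M i j ≈ M i x * M y j + M i y * M x j
      schur i j with j Fin.≟ x | j Fin.≟ y
      -- For `j` equal to `x` or `y` the three columns are not distinct, but then the identity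
      -- follows from the zero diagonal.
      ... | yes refl | _ = begin
        M x y * M i x                 ≈⟨ Eq.trans (*-congʳ (M-sym x y)) (*-comm _ _) ⟩
        M i x * M y x                 ≈⟨ +-identityʳ _ ⟨
        M i x * M y x + 0#            ≈⟨ +-congˡ (Eq.trans (*-congˡ (M-diagonal₀ x)) (zeroʳ _)) ⟨
        M i x * M y x + M i y * M x x ∎
      ... | no _ | yes refl = begin
        M x y * M i y                 ≈⟨ *-comm _ _ ⟩
        M i y * M x y                 ≈⟨ +-identityˡ _ ⟨
        0# + M i y * M x y            ≈⟨ +-congʳ (Eq.trans (*-congˡ (M-diagonal₀ y)) (zeroʳ _)) ⟨
        M i x * M y y + M i y * M x y ∎
      ... | no j≢x | no j≢y = schur-vanishes M (M-diagonal₀ x) (M-diagonal₀ y) (M-sym y x) (M-edge≉0 x~y)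
        (dependent (~⇒≢ x~y) (j≢x ∘ sym) (j≢y ∘ sym)) i

      schur-y : ∀ {i} j → ¬ i ~ x → M x y * M i j ≈ M i y * M x j
      schur-y {i} j i≁x = begin
        M x y * M i j                 ≈⟨ schur i j ⟩
        M i x * M y j + M i y * M x j ≈⟨ +-congʳ (Eq.trans (*-congʳ (M-nonedge₀ μ≈0 i≁x)) (zeroˡ _)) ⟩
        0# + M i y * M x j            ≈⟨ +-identityˡ _ ⟩
        M i y * M x j                 ∎

      -- For a vertex `i` adjacent to neither, the Schur identity would make row `i` vanish,
      -- although `i` has a neighbour.
      side : ∀ i → i ~ x ⊎ i ~ y
      side i with i ~? x | i ~? y
      ... | yes p  | _      = inj₁ p
      ... | no  _  | yes q  = inj₂ q
      ... | no i≁x | no i≁y with j , i~j ← has-neighbour conn x~y i =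
        contradiction (*-cancel-0 (M-edge≉0 x~y) (begin
          M x y * M i j ≈⟨ schur-y j i≁x ⟩
          M i y * M x j ≈⟨ *-congʳ (M-nonedge₀ μ≈0 i≁y) ⟩
          0# * M x j    ≈⟨ zeroˡ _ ⟩
          0#            ∎)) (M-edge≉0 i~j)

      ~x⇒≁y : ∀ {i} → i ~ x → ¬ i ~ y
      ~x⇒≁y i~x i~y = triangle-free i~x x~y (~-sym i~y)

      -- The part containing `x`; by `side` its complement consists of neighbours of `x`.
      S : Subset n
      S = separate (_~? y)

      ∈S : ∀ {i} → i ~ y → i ∈ S
      ∈S = ∈-separate⁺ (_~? y)

      ∉S : ∀ {i} → ¬ i ~ y → i ∉ S
      ∉S i≁y i∈S = i≁y (∈-separate⁻ (_~? y) i∈S)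

      ∉S⇒~x : ∀ {i} → i ∉ S → i ~ x
      ∉S⇒~x {i} i∉S with side i
      ... | inj₁ i~x = i~x
      ... | inj₂ i~y = contradiction (∈S i~y) i∉S

      -- By the Schur identity `M x y * M i j` is the product of the nonzero entries `M i y` and
      -- `M x j`.
      join : ∀ {i j} → i ~ y → j ~ x → i ~ j
      join {i} {j} i~y j~x = decidable-stable (i ~? j) λ i≁j →
        M-edge≉0 (~-sym j~x) (*-cancel-0 (M-edge≉0 i~y) (begin
          M i y * M x j ≈⟨ schur-y j (λ i~x → ~x⇒≁y i~x i~y) ⟨
          M x y * M i j ≈⟨ *-congˡ (M-nonedge₀ μ≈0 i≁j) ⟩
          M x y * 0#    ≈⟨ zeroʳ _ ⟩
          0#            ∎))

      bipartition : ∀ i j → i ~ j ⇔ ((i ∈ S × j ∉ S) ⊎ (i ∉ S × j ∈ S))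
      bipartition i j = mk⇔ to from
        where
        to : i ~ j → (i ∈ S × j ∉ S) ⊎ (i ∉ S × j ∈ S)
        to i~j with side i | side j
        ... | inj₁ i~x | inj₁ j~x = contradiction (~-sym i~x) (triangle-free i~j j~x)
        ... | inj₁ i~x | inj₂ j~y = inj₂ (∉S (~x⇒≁y i~x) , ∈S j~y)
        ... | inj₂ i~y | inj₁ j~x = inj₁ (∈S i~y , ∉S (~x⇒≁y j~x))
        ... | inj₂ i~y | inj₂ j~y = contradiction (~-sym i~y) (triangle-free i~j j~y)
        from : (i ∈ S × j ∉ S) ⊎ (i ∉ S × j ∈ S) → i ~ j
        from (inj₁ (i∈S , j∉S)) = join (∈-separate⁻ (_~? y) i∈S) (∉S⇒~x j∉S)
        from (inj₂ (i∉S , j∈S)) = ~-sym (join (∈-separate⁻ (_~? y) j∈S) (∉S⇒~x i∉S))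

      -- The sign of a walk from `i` to `x`, either direct or through `y`.
      θ′ : ∀ {i} → i ~ x ⊎ i ~ y → Sign
      θ′ (inj₁ i~x) = σ i~x
      θ′ (inj₂ i~y) = σ x~y Sign.* σ i~y

      -- The Schur identity for `i` and `j`, read in signs: the square on `x`, `y`, `i`, `j` is
      -- positive.
      edge-sign : ∀ {i j} (i~j : i ~ j) (i~y : i ~ y) (j~x : j ~ x) →
                  σ i~j ≡ (σ x~y Sign.* σ i~y) Sign.* σ j~x
      edge-sign {i} {j} i~j i~y j~x = trans (*-movesˡ (σ x~y) product) (sym (Sign.*-assoc (σ x~y) _ _))
        where
        product : σ x~y Sign.* σ i~j ≡ σ i~y Sign.* σ j~x
        product = trans (sym (opposite-*-opposite (σ x~y) (σ i~j))) (trans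
          (signs-agree (Sign.opposite (σ x~y)) (Sign.opposite (σ i~j))
            (Sign.opposite (σ i~y)) (Sign.opposite (σ j~x)) (M-edge x~y) (M-edge i~j) (M-edge i~y)
            (Eq.trans (M-sym x j) (M-edge j~x)) (schur-y j (λ i~x → ~x⇒≁y i~x i~y)))
          (opposite-*-opposite (σ i~y) (σ j~x)))

      switched : ∀ {i j} (si : i ~ x ⊎ i ~ y) (sj : j ~ x ⊎ j ~ y) (p : i ~ j) →
                 σ p ≡ θ′ si Sign.* θ′ sj
      switched (inj₁ i~x) (inj₁ j~x) p = contradiction (~-sym i~x) (triangle-free p j~x)
      switched (inj₂ i~y) (inj₂ j~y) p = contradiction (~-sym i~y) (triangle-free p j~y)
      switched (inj₂ i~y) (inj₁ j~x) p = edge-sign p i~y j~x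
      switched (inj₁ i~x) (inj₂ j~y) p = trans (σ-sym p (~-sym p))
        (trans (edge-sign (~-sym p) j~y i~x) (Sign.*-comm _ (σ i~x)))

      classify : (∃[ n₁ ] ∃[ n₂ ] 2 ℕ.≤ n₁ × 2 ℕ.≤ n₂ × IsCompleteBipartite G n₁ n₂)
                 × Balanced G × μ ≈ 0#
      classify =
        ( _ , _
        -- The cycle of length 4 supplies two vertices of each part: `x` and `f 2` are adjacent to
        -- `y`, while `y` and `f 3` are not.
        , two-elements x≢f₂ (∈S x~y) (∈S (~-sym y~f₂))
        , two-elements y≢f₃ (x∉p⇒x∈∁p (∉S (~-irrefl refl))) (x∉p⇒x∈∁p (∉S f₃≁y))
        , S , refl , refl , bipartition)
        , switched⇒balanced G (θ′ ∘ side) (λ {i} {j} → switched (side i) (side j)) , μ≈0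

    -- Rank bounds in the extremal families

    -- Any two columns are proportional. Writing `μ` as the sign `δ` treats both cases at once:
    -- triangles have sign `+` when `μ` is -1 and sign `-` when `μ` is 1.
    complete⇒rank≤1 : IsComplete G → ∀ {δ} → μ ≈ signValue δ →
      (∀ {i j k} (p : i ~ j) (q : j ~ k) (r : k ~ i) → σ p Sign.* (σ q Sign.* σ r) ≡ Sign.opposite δ) →
      ∀ {r} → IsRank M r → r ℕ.≤ 1
    complete⇒rank≤1 complete {δ} μ≈δ triangle-sign isRank = rank≤ isRank 1 λ col inj →
      let a = col fzero
          b = col (fsuc fzero)
          a~b = complete a b (λ eq → Fin.0≢1+n (inj eq))
      in relation⇒¬free M col {fzero} {fsuc fzero} (λ ()) 1≉0 (relation a~b)
      where
      module _ {a b} (a~b : a ~ b) where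
        -- The factor is forced by row `a`, where the entries are `δ` and the opposite of `σ a~b`.
        w : Sign
        w = δ Sign.* σ a~b

        cancel : ∀ {i} α β → M i a ≈ signValue α → M i b ≈ signValue β → α ≡ Sign.opposite (β Sign.* w) →
                 M i a * 1# + M i b * signValue w ≈ 0#
        cancel α β Mia≈ Mib≈ eq = Eq.trans (+-cong (*-congʳ Mia≈) (*-congʳ Mib≈))
          (signs-cancel α Sign.+ β w (trans (Sign.*-identityʳ α) eq))

        relation : ∀ i → M i a * 1# + M i b * signValue w ≈ 0#
        relation i with i Fin.≟ a | i Fin.≟ b
        ... | yes refl | _ = cancel δ (Sign.opposite (σ a~b)) (Eq.trans (M-diagonal i) μ≈δ) (M-edge a~b)
          (diagonal-sign δ (σ a~b))
        ... | no _ | yes refl = cancel (Sign.opposite (σ a~b)) δ (Eq.trans (M-sym i a) (M-edge a~b))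
          (Eq.trans (M-diagonal i) μ≈δ) (cong Sign.opposite (*-movesˡ δ refl))
        ... | no i≢a | no i≢b = cancel (Sign.opposite (σ i~a)) (Sign.opposite (σ i~b))
          (M-edge i~a) (M-edge i~b)
          (cong Sign.opposite (triangle-signs δ (σ i~a) (σ a~b) (σ i~b)
            (trans (cong (λ t → σ i~a Sign.* (σ a~b Sign.* t)) (σ-sym i~b (~-sym i~b)))
              (triangle-sign i~a a~b (~-sym i~b)))))
          where
          i~a = complete i a i≢a
          i~b = complete i b i≢b

    module Bipartite {S : Subset n} (bipartition : ∀ i j → i ~ j ⇔ ((i ∈ S × j ∉ S) ⊎ (i ∉ S × j ∈ S))) where

      bipartite-triangle-free : ∀ {a b c} → a ~ b → b ~ c → ¬ c ~ a
      bipartite-triangle-free {a} {b} {c} p q r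
        with Equivalence.to (bipartition a b) p | Equivalence.to (bipartition b c) q
           | Equivalence.to (bipartition c a) r
      ... | inj₁ (_ , b∉)  | inj₁ (b∈ , _)  | _ = b∉ b∈
      ... | inj₁ (a∈ , _)  | inj₂ (_ , c∈)  | inj₁ (_ , a∉) = a∉ a∈
      ... | inj₁ (a∈ , _)  | inj₂ (_ , c∈)  | inj₂ (c∉ , _) = c∉ c∈
      ... | inj₂ (a∉ , _)  | inj₁ (_ , c∉)  | inj₁ (c∈ , _) = c∉ c∈
      ... | inj₂ (a∉ , _)  | inj₁ (_ , c∉)  | inj₂ (_ , a∈) = a∉ a∈
      ... | inj₂ (_ , b∈)  | inj₂ (b∉ , _)  | _ = b∉ b∈

      -- Valued in `Fin 2`, so that pigeonhole finds two columns of the same part among any three.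
      part : Fin n → Fin 2
      part i with i ∈? S
      ... | yes _ = fzero
      ... | no  _ = fsuc fzero

      twins : ∀ {a b} → part a ≡ part b → ∀ {i} → i ~ a → i ~ b
      twins {a} {b} eq {i} p with a ∈? S | b ∈? S | Equivalence.to (bipartition i a) p
      ... | yes _  | yes b∈ | inj₂ (i∉ , _) = Equivalence.from (bipartition i b) (inj₂ (i∉ , b∈))
      ... | yes a∈ | yes _  | inj₁ (_ , a∉) = contradiction a∈ a∉
      ... | no  _  | no  b∉ | inj₁ (i∈ , _) = Equivalence.from (bipartition i b) (inj₁ (i∈ , b∉))
      ... | no  a∉ | no  _  | inj₂ (_ , a∈) = contradiction a∈ a∉

      -- Two vertices of the same part have the same neighbours, and balance of the squares through
      -- them makes their columns proportional.
      rank≤2 : Connected G → Balanced G → μ ≈ 0# → ∀ {x y} → x ~ y → ∀ {r} → IsRank M r → r ℕ.≤ 2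
      rank≤2 conn balanced μ≈0 x~y isRank = rank≤ isRank 2 λ col inj →
        let s , t , s<t , eq = pigeonhole ℕ.≤-refl (part ∘ col)
            s≢t = Fin.<⇒≢ s<t
            o , a~o = has-neighbour conn x~y (col s)
            o~a = ~-sym a~o
        in relation⇒¬free M col s≢t (signValue≉0 (σ (twins eq o~a)))
             (relation (s≢t ∘ inj) eq o~a)
        where
        module _ {a b} (a≢b : a ≢ b) (eq : part a ≡ part b) {o} (o~a : o ~ a) where
          o~b : o ~ b
          o~b = twins eq o~a

          square-sign : ∀ {i} (i~a : i ~ a) (i~b : i ~ b) →
                        σ i~a Sign.* (σ o~a Sign.* (σ o~b Sign.* σ i~b)) ≡ Sign.+
          square-sign {i} i~a i~b with i Fin.≟ o
          ... | no i≢o = trans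
            (cong₂ (λ s t → σ i~a Sign.* (s Sign.* (σ o~b Sign.* t))) (σ-sym o~a (~-sym o~a)) (σ-sym i~b (~-sym i~b)))
            (balanced (square G i≢o a≢b i~a (~-sym o~a) o~b (~-sym i~b)))
          -- For `i` equal to `o` the square degenerates to two edges, each used twice, and the
          -- signs cancel without appeal to balance.
          ... | yes refl = trans
            (cong₂ (λ s t → s Sign.* (σ o~a Sign.* (σ o~b Sign.* t))) (σ-irrelevant i~a o~a) (σ-irrelevant i~b o~b))
            (trans (cong (λ s → σ o~a Sign.* (σ o~a Sign.* s)) (Sign.s*s≡+ (σ o~b)))
              (trans (sym (Sign.*-assoc (σ o~a) _ _)) (cong (Sign._* Sign.+) (Sign.s*s≡+ (σ o~a)))))

          -- The coefficients are those that make row `o` vanish, `o` being a common neighbour;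
          -- balance carries the relation to every other row.
          relation : ∀ i → M i a * signValue (σ o~b) + M i b * signValue (Sign.opposite (σ o~a)) ≈ 0#
          relation i with i ~? a
          ... | no  i≁a = Eq.trans (+-cong
            (Eq.trans (*-congʳ (M-nonedge₀ μ≈0 i≁a)) (zeroˡ _))
            (Eq.trans (*-congʳ (M-nonedge₀ μ≈0 (i≁a ∘ twins (sym eq)))) (zeroˡ _))) (+-identityʳ 0#)
          ... | yes i~a = Eq.trans
            (+-cong (*-congʳ (M-edge i~a)) (*-congʳ (M-edge i~b)))
            (signs-cancel (Sign.opposite (σ i~a)) (σ o~b) (Sign.opposite (σ i~b)) (Sign.opposite (σ o~a))
              (square-signs (σ i~a) (σ o~b) (σ o~a) (σ i~b) (square-sign i~a i~b)))
            where i~b = twins eq i~a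

    -- Comparison of the rank with the girth

    rank≤order : ∀ {r} → IsRank M r → r ℕ.≤ n
    rank≤order ((S , _ , refl) , _) = ∣p∣≤n S

    module _ (conn : Connected G) {m : ℕ} (girth : IsGirth G (2 ℕ.+ m)) (g<n : 2 ℕ.+ m ℕ.< n)
             {r : ℕ} (isRank : IsRank M r) where

      Extremal : Set ℓ
      Extremal = (IsComplete G × Balanced G × μ ≈ - 1#)
               ⊎ (IsComplete G × Antibalanced G × μ ≈ 1#)
               ⊎ ((∃[ n₁ ] ∃[ n₂ ] 2 ℕ.≤ n₁ × 2 ℕ.≤ n₂ × IsCompleteBipartite G n₁ n₂)
                  × Balanced G × μ ≈ 0#)

      -- Dropping `f (suc m)` from a shortest cycle leaves an induced path with `m` edges.
      girth-2≤rank : m ℕ.≤ r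
      girth-2≤rank with u , f , C , _ ← attached-circuit G conn girth g<n =
        induced-path≤rank (prefix G (ℕ.n≤1+n m) path)
          (λ 2≤d d+i≤m → girth-chordless G girth path 2≤d d+i≤m) isRank
        where open Circuit C

      1≤m : 1 ℕ.≤ m
      1≤m = ℕ.≤-pred (ℕ.≤-pred (3≤length G girth))

      extremal : r ≡ m → Extremal
      extremal refl with u , f , C , u∉ , u~f₀ ← attached-circuit G conn girth g<n
        with attach G girth 1≤m C u∉ u~f₀
      -- The prolonged induced path has `suc m` edges and would force the rank above `m`.
      ... | inj₁ (P , chordless) = contradiction (induced-path≤rank P chordless isRank) ℕ.1+n≰n
      ... | inj₂ (m<3 , u~fₘ) = go 1≤m m<3 isRank C u∉ u~fₘ girth
        where
        -- The facts about the fixed `m` are restated for a bound one, so that it can be split into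
        -- the values 1 and 2, that is girth 3 and girth 4.
        go : ∀ {m} → 1 ℕ.≤ m → suc m ℕ.≤ 3 → IsRank M m → Circuit G (suc m) f → Avoids G u (suc m) f →
             u ~ f m → IsGirth G (2 ℕ.+ m) → Extremal
        go {suc zero} _ _ rank1 C _ _ _ with RankOne.classify rank1 (Circuit.close C)
        ... | inj₁ case = inj₁ case
        ... | inj₂ case = inj₂ (inj₁ case)
        go {suc (suc zero)} _ _ rank2 C u∉ u~f₂ girth = inj₂ (inj₂
          (RankTwo.classify rank2 conn (no-triangle G girth ℕ.≤-refl) C u∉ u~f₀ u~f₂))
        go {suc (suc (suc _))} _ (s≤s (s≤s (s≤s ()))) _ _ _ _ _

      extremal⇒rank≤ : Extremal → r ℕ.≤ m
      extremal⇒rank≤ (inj₁ (complete , balanced , μ≈-1)) = ℕ.≤-trans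
        (complete⇒rank≤1 complete {Sign.-} μ≈-1 (λ p q r → balanced (triangle G p q r)) isRank) 1≤m
      extremal⇒rank≤ (inj₂ (inj₁ (complete , antibalanced , μ≈1))) = ℕ.≤-trans
        (complete⇒rank≤1 complete {Sign.+} μ≈1
          (λ p q r → proj₂ (antibalanced (triangle G p q r)) (from-no (2 ∣? 3))) isRank) 1≤m
      extremal⇒rank≤ (inj₂ (inj₂ ((_ , _ , _ , _ , S , _ , _ , bipartition) , balanced , μ≈0)))
        with u , f , C , _ , u~f₀ ← attached-circuit G conn girth g<n =
        ℕ.≤-trans (rank≤2 conn balanced μ≈0 u~f₀ isRank) (2≤ 1≤m C)
        where
        open Bipartite bipartition
        -- The value 1 would mean girth 3, but a bipartite graph has no triangle.
        2≤ : ∀ {m} → 1 ℕ.≤ m → Circuit G (suc m) f → 2 ℕ.≤ m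
        2≤ {suc zero}    _ C = contradiction close (bipartite-triangle-free (step (s≤s z≤n)) (step ℕ.≤-refl))
          where open Circuit C
        2≤ {suc (suc _)} _ _ = s≤s (s≤s z≤n)

-- From ranks to multiplicities

open import Data.Nat.Base using (_≤_; _<_; _+_; _∸_)

n∸2+m+2≡n∸m : ∀ {n} m → 2 + m ≤ n → (n ∸ (2 + m)) + 2 ≡ n ∸ m
n∸2+m+2≡n∸m {suc (suc n)} m (s≤s (s≤s m≤n)) = trans (ℕ.+-comm (n ∸ m) 2) (sym (ℕ.+-∸-assoc 2 m≤n))

theorem3 : ∀ {c ℓ} (ℝ : CompleteOrderedField c ℓ) →
    let open CompleteOrderedField ℝ using (Carrier)
        open CompleteOrderedField ℝ using (_≈_)
        open CompleteOrderedField ℝ using (0#)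
        open CompleteOrderedField ℝ using (1#)
        open CompleteOrderedField ℝ using (-_)
        open Spectral ℝ using (IsEigenvalue)
        open Spectral ℝ using (multiplicity) in
    ∀ (n : ℕ) (G : SignedGraph n) → 3 ≤ n → Connected G → Cycle G →
    ∀ (g : ℕ) → IsGirth G g → g < n →
    ∀ (μ : Carrier) → IsEigenvalue G μ →
      multiplicity G μ ≤ (n ∸ g) + 2
      × (multiplicity G μ ≡ (n ∸ g) + 2 ⇔
          ( (IsComplete G × Balanced G × μ ≈ - 1#)
          ⊎ (IsComplete G × Antibalanced G × μ ≈ 1#)
          ⊎ ((∃[ n₁ ] ∃[ n₂ ] 2 ≤ n₁ × 2 ≤ n₂ × IsCompleteBipartite G n₁ n₂)
              × Balanced G × μ ≈ 0#)))
theorem3 ℝ n G _ conn _ zero          girth g<n μ _ with () ← 3≤length G girth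
theorem3 ℝ n G _ conn _ (suc zero)    girth g<n μ _ with s≤s () ← 3≤length G girth
theorem3 ℝ n G _ conn _ (suc (suc m)) girth g<n μ _
  with r , isRank , eq ← Spectrum.multiplicity-rank ℝ G μ
  rewrite eq | n∸2+m+2≡n∸m m (ℕ.<⇒≤ g<n) =
  ℕ.∸-monoʳ-≤ n m≤r ,
  mk⇔ (λ n∸r≡n∸m → extremal G μ conn girth g<n isRank
        -- Truncated subtraction from `n` can be cancelled because both `r` and `m` are at most `n`.
        (ℕ.∸-cancelˡ-≡ (rank≤order G μ isRank) (ℕ.m+n≤o⇒n≤o 2 (ℕ.<⇒≤ g<n)) n∸r≡n∸m))
      (λ ext → cong (n ∸_) (ℕ.≤-antisym (extremal⇒rank≤ G μ conn girth g<n isRank ext) m≤r))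
  where
  open Spectrum ℝ
  m≤r = girth-2≤rank G μ conn girth g<n isRank
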